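{- Let $(X,\mathcal F)$ be a (finite) hypergraph with maximum degree $\Delta$, let $\lambda\in(0,1)$, and let $f$ be a positive integer. Let $\tau_f$ denote the $f$-fold transversal number and $\tau^{\ast}$ the fractional transversal number of $(X,\mathcal F)$. Then $$\tau_f\leq \frac{1-\lambda^f}{1-\lambda}\,\tau^{\ast}\,\bigl(1+\ln \Delta -(f-1)\ln \lambda\bigr).$$ Moreover, if $\lambda$ is rational, then the $\lambda$-weighted greedy algorithm (described in the context) yields an $f$-fold transversal of $(X,\mathcal F)$ whose cardinality, counted with multiplicity, does not exceed the right hand side of this inequality.
   Context: A hypergraph is a pair $(X,\mathcal F)$, where $X$ is a finite set (the vertices) and $\mathcal F\subseteq 2^X$ is a family of subsets of $X$ (the edges). It is tacitly assumed that $\mathcal F$ is nonempty and that every edge is nonempty. The maximum degree $\Delta$ is the maximum number of edges a vertex is contained in. An $f$-fold transversal of $(X,\mathcal F)$ is a multiset $A$ of elements of $X$ such that each $F\in\mathcal F$ contains at least $f$ elements of $A$, counted with multiplicity. The $f$-fold transversal number $\tau_f$ is the minimum cardinality (with multiplicity) of an $f$-fold transversal. A fractional transversal is a function $w:X\to[0,1]$ with $\sum_{x\in F}w(x)\ge 1$ for all $F\in\mathcal F$; the fractional transversal number is $\tau^{\ast}=\inf\{\sum_{x\in X}w(x) : w \text{ is a fractional transversal}\}$. The $\lambda$-weighted greedy algorithm: vertices are picked one by one, with repetition allowed. At any stage, for $F\in\mathcal F$ let $k(F)$ be the number of vertices picked so far (with multiplicity) that lie in $F$; initially $k\equiv 0$.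 The value of a vertex $x$ at this stage is $v_k(x)=\sum_{F\in\mathcal F,\ x\in F,\ k(F)<f}\lambda^{k(F)}$. At each step one picks a vertex of largest value (ties broken arbitrarily). The algorithm stops once $k(F)\ge f$ for every $F\in\mathcal F$; its output is the multiset of picked vertices. -}

module Defs where

open import Data.Empty using (⊥-elim)
open import Data.Fin.Base using (Fin)
open import Data.Fin.Subset using (Subset; Nonempty) renaming (_∈_ to _∈ˢ_)
open import Data.Fin.Subset.Properties using () renaming (_∈?_ to _∈ˢ?_)
open import Data.Integer.Base as ℤ using (+_)
import Data.Integer.Properties as ℤ
open import Data.List.Base using (List; []; _∷_; length; filter; map; foldr; allFin)
open import Data.List.Extrema.Nat using (max; xs≤max)
open import Data.List.Membership.Propositional using (_∈_)
open import Data.List.Membership.Propositional.Properties using (∈-filter⁺; ∈-map⁺; ∈-allFin)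
open import Data.List.Relation.Unary.All as All using ()
open import Data.List.Relation.Unary.Any using (here; there)
open import Data.List.Relation.Unary.Unique.Propositional using (Unique)
open import Data.Nat.Base as ℕ using (ℕ; zero; suc)
import Data.Nat.Properties as ℕ
open import Data.Product using (∃-syntax; _×_; _,_; proj₁; proj₂)
open import Data.Rational.Base as ℚ using (ℚ; 0ℚ; 1ℚ; mkℚ; toℚᵘ; ∣_∣)
import Data.Rational.Properties as ℚ
open import Data.Rational.Solver using (module +-*-Solver)
import Data.Rational.Unnormalised.Base as ℚᵘ
import Data.Rational.Unnormalised.Properties as ℚᵘ
open import Data.Sum.Base using (inj₁; inj₂)
open import Relation.Binary.PropositionalEquality
  using (_≡_; refl; sym; trans; cong; cong₂; subst; subst₂)
open import Relation.Nullary using (¬_; yes; no)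
open import Relation.Nullary.Decidable using (_×-dec_)

module RationalFacts where

  open +-*-Solver

  nat : ℕ → ℚ
  nat zero    = 0ℚ
  nat (suc n) = 1ℚ ℚ.+ nat n

  -- Total inverse, with inv 0ℚ ≡ 0ℚ; it is only ever used at nonzero arguments.
  inv : ℚ → ℚ
  inv p with p ℚ.≟ 0ℚ
  ... | yes _   = 0ℚ
  ... | no  p≢0 = ℚ.1/_ p {{ℚ.≢-nonZero p≢0}}

  0<1 : 0ℚ ℚ.< 1ℚ
  0<1 = ℚ.positive⁻¹ 1ℚ

  0≤1 : 0ℚ ℚ.≤ 1ℚ
  0≤1 = ℚ.<⇒≤ 0<1

  ≤⇒0≤- : ∀ {p q} → p ℚ.≤ q → 0ℚ ℚ.≤ q ℚ.- p
  ≤⇒0≤- {p} {q} p≤q =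
    subst (ℚ._≤ q ℚ.- p) (ℚ.+-inverseʳ p) (ℚ.+-monoˡ-≤ (ℚ.- p) p≤q)

  0≤-⇒≤ : ∀ {p q} → 0ℚ ℚ.≤ q ℚ.- p → p ℚ.≤ q
  0≤-⇒≤ {p} {q} h = subst₂ ℚ._≤_ (ℚ.+-identityˡ p)
    (solve 2 (λ q p → (q :- p) :+ p := q) refl q p) (ℚ.+-monoˡ-≤ p h)

  0≤+ : ∀ {p q} → 0ℚ ℚ.≤ p → 0ℚ ℚ.≤ q → 0ℚ ℚ.≤ p ℚ.+ q
  0≤+ = ℚ.+-mono-≤

  0<+ : ∀ {p q} → 0ℚ ℚ.< p → 0ℚ ℚ.≤ q → 0ℚ ℚ.< p ℚ.+ q
  0<+ = ℚ.+-mono-<-≤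

  *-monoˡ : ∀ {r p q} → 0ℚ ℚ.≤ r → p ℚ.≤ q → r ℚ.* p ℚ.≤ r ℚ.* q
  *-monoˡ {r} 0≤r = ℚ.*-monoˡ-≤-nonNeg r {{ℚ.nonNegative 0≤r}}

  *-monoʳ : ∀ {r p q} → 0ℚ ℚ.≤ r → p ℚ.≤ q → p ℚ.* r ℚ.≤ q ℚ.* r
  *-monoʳ {r} 0≤r = ℚ.*-monoʳ-≤-nonNeg r {{ℚ.nonNegative 0≤r}}

  0≤* : ∀ {p q} → 0ℚ ℚ.≤ p → 0ℚ ℚ.≤ q → 0ℚ ℚ.≤ p ℚ.* q
  0≤* {p} {q} 0≤p 0≤q = subst (ℚ._≤ p ℚ.* q) (ℚ.*-zeroʳ p) (*-monoˡ 0≤p 0≤q)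

  0<* : ∀ {p q} → 0ℚ ℚ.< p → 0ℚ ℚ.< q → 0ℚ ℚ.< p ℚ.* q
  0<* {p} {q} 0<p 0<q =
    subst (ℚ._< p ℚ.* q) (ℚ.*-zeroʳ p) (ℚ.*-monoʳ-<-pos p {{ℚ.positive 0<p}} 0<q)

  *-mono : ∀ {a b c d} → 0ℚ ℚ.≤ b → 0ℚ ℚ.≤ c → a ℚ.≤ b → c ℚ.≤ d → a ℚ.* c ℚ.≤ b ℚ.* d
  *-mono 0≤b 0≤c a≤b c≤d = ℚ.≤-trans (*-monoʳ 0≤c a≤b) (*-monoˡ 0≤b c≤d)

  ∣a-b∣≡∣b-a∣ : ∀ a b → ∣ a ℚ.- b ∣ ≡ ∣ b ℚ.- a ∣
  ∣a-b∣≡∣b-a∣ a b = trans (cong ∣_∣ (solve 2 (λ a b → a :- b := :- (b :- a)) refl a b))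
                         (ℚ.∣-p∣≡∣p∣ (b ℚ.- a))

  triangle : ∀ a b c → ∣ a ℚ.- c ∣ ℚ.≤ ∣ a ℚ.- b ∣ ℚ.+ ∣ b ℚ.- c ∣
  triangle a b c = subst (ℚ._≤ ∣ a ℚ.- b ∣ ℚ.+ ∣ b ℚ.- c ∣)
    (cong ∣_∣ (solve 3 (λ a b c → (a :- b) :+ (b :- c) := a :- c) refl a b c))
    (ℚ.∣p+q∣≤∣p∣+∣q∣ (a ℚ.- b) (b ℚ.- c))

  product-dist : ∀ a b c d →
    ∣ a ℚ.* b ℚ.- c ℚ.* d ∣ ℚ.≤ ∣ b ∣ ℚ.* ∣ a ℚ.- c ∣ ℚ.+ ∣ c ∣ ℚ.* ∣ b ℚ.- d ∣
  product-dist a b c d = subst₂ ℚ._≤_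
    (cong ∣_∣ split)
    (cong₂ ℚ._+_ (ℚ.∣p*q∣≡∣p∣*∣q∣ b (a ℚ.- c)) (ℚ.∣p*q∣≡∣p∣*∣q∣ c (b ℚ.- d)))
    (ℚ.∣p+q∣≤∣p∣+∣q∣ (b ℚ.* (a ℚ.- c)) (c ℚ.* (b ℚ.- d)))
    where
    split : b ℚ.* (a ℚ.- c) ℚ.+ c ℚ.* (b ℚ.- d) ≡ a ℚ.* b ℚ.- c ℚ.* d
    split = solve 4 (λ a b c d → b :* (a :- c) :+ c :* (b :- d) := a :* b :- c :* d) refl a b c d

  product-close : ∀ a b c d {A B ε} → 0ℚ ℚ.≤ A → 0ℚ ℚ.≤ B → ∣ b ∣ ℚ.≤ B → ∣ c ∣ ℚ.≤ A →
    ∣ a ℚ.- c ∣ ℚ.≤ ε → ∣ b ℚ.- d ∣ ℚ.≤ ε →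
    ∣ a ℚ.* b ℚ.- c ℚ.* d ∣ ℚ.≤ (B ℚ.+ A) ℚ.* ε
  product-close a b c d {A} {B} {ε} 0≤A 0≤B b≤B c≤A ac≤ε bd≤ε =
    ℚ.≤-trans (product-dist a b c d)
      (subst (∣ b ∣ ℚ.* ∣ a ℚ.- c ∣ ℚ.+ ∣ c ∣ ℚ.* ∣ b ℚ.- d ∣ ℚ.≤_)
        (sym (ℚ.*-distribʳ-+ ε B A))
        (ℚ.+-mono-≤ (*-mono 0≤B (ℚ.0≤∣p∣ (a ℚ.- c)) b≤B ac≤ε)
                    (*-mono 0≤A (ℚ.0≤∣p∣ (b ℚ.- d)) c≤A bd≤ε)))

  inv-inverse : ∀ {p} → 0ℚ ℚ.< p → p ℚ.* inv p ≡ 1ℚ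
  inv-inverse {p} 0<p with p ℚ.≟ 0ℚ
  ... | yes refl = ⊥-elim (ℚ.<-irrefl refl 0<p)
  ... | no  p≢0  = ℚ.*-inverseʳ p {{ℚ.≢-nonZero p≢0}}

  inv-pos : ∀ {p} → 0ℚ ℚ.< p → 0ℚ ℚ.< inv p
  inv-pos {p} 0<p with p ℚ.≟ 0ℚ
  ... | yes refl = ⊥-elim (ℚ.<-irrefl refl 0<p)
  ... | no  p≢0  =
    ℚ.positive⁻¹ (ℚ.1/_ p {{ℚ.≢-nonZero p≢0}}) {{ℚ.1/pos⇒pos p {{ℚ.positive 0<p}}}}

  *-inv-cancel : ∀ a {b} → 0ℚ ℚ.< b → a ≡ a ℚ.* (b ℚ.* inv b)
  *-inv-cancel a 0<b = trans (sym (ℚ.*-identityʳ a)) (cong (a ℚ.*_) (sym (inv-inverse 0<b)))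

  inv-diff : ∀ {p q} → 0ℚ ℚ.< p → 0ℚ ℚ.< q →
             inv p ℚ.- inv q ≡ (q ℚ.- p) ℚ.* (inv p ℚ.* inv q)
  inv-diff {p} {q} 0<p 0<q = trans
    (cong₂ ℚ._-_ (*-inv-cancel (inv p) 0<q) (*-inv-cancel (inv q) 0<p))
    (solve 4 (λ p q u v → u :* (q :* v) :- v :* (p :* u) := (q :- p) :* (u :* v))
       refl p q (inv p) (inv q))

  inv-anti : ∀ {p q} → 0ℚ ℚ.< p → p ℚ.≤ q → inv q ℚ.≤ inv p
  inv-anti {p} {q} 0<p p≤q = 0≤-⇒≤ (subst (0ℚ ℚ.≤_) (sym (inv-diff 0<p 0<q))
    (0≤* (≤⇒0≤- p≤q) (0≤* (ℚ.<⇒≤ (inv-pos 0<p)) (ℚ.<⇒≤ (inv-pos 0<q)))))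
    where 0<q = ℚ.<-≤-trans 0<p p≤q

  inv-product : ∀ {δ p q} → 0ℚ ℚ.< δ → δ ℚ.≤ p → δ ℚ.≤ q →
                ∣ inv p ℚ.* inv q ∣ ℚ.≤ inv δ ℚ.* inv δ
  inv-product {δ} {p} {q} 0<δ δ≤p δ≤q = subst (ℚ._≤ inv δ ℚ.* inv δ)
    (sym (ℚ.0≤p⇒∣p∣≡p (0≤* 0≤p⁻¹ 0≤q⁻¹)))
    (*-mono (ℚ.<⇒≤ (inv-pos 0<δ)) 0≤q⁻¹ (inv-anti 0<δ δ≤p) (inv-anti 0<δ δ≤q))
    where
    0≤p⁻¹ = ℚ.<⇒≤ (inv-pos (ℚ.<-≤-trans 0<δ δ≤p))
    0≤q⁻¹ = ℚ.<⇒≤ (inv-pos (ℚ.<-≤-trans 0<δ δ≤q))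

  inv-dist : ∀ {δ p q} → 0ℚ ℚ.< δ → δ ℚ.≤ p → δ ℚ.≤ q →
             ∣ inv p ℚ.- inv q ∣ ℚ.≤ ∣ p ℚ.- q ∣ ℚ.* (inv δ ℚ.* inv δ)
  inv-dist {δ} {p} {q} 0<δ δ≤p δ≤q = subst (ℚ._≤ ∣ p ℚ.- q ∣ ℚ.* (inv δ ℚ.* inv δ))
    (sym (trans (cong ∣_∣ (inv-diff (ℚ.<-≤-trans 0<δ δ≤p) (ℚ.<-≤-trans 0<δ δ≤q)))
         (trans (ℚ.∣p*q∣≡∣p∣*∣q∣ (q ℚ.- p) (inv p ℚ.* inv q))
                (cong (ℚ._* ∣ inv p ℚ.* inv q ∣) (∣a-b∣≡∣b-a∣ q p)))))
    (*-monoˡ (ℚ.0≤∣p∣ (p ℚ.- q)) (inv-product 0<δ δ≤p δ≤q))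

  nat-+ : ∀ m n → nat (m ℕ.+ n) ≡ nat m ℚ.+ nat n
  nat-+ zero    n = sym (ℚ.+-identityˡ (nat n))
  nat-+ (suc m) n = trans (cong (1ℚ ℚ.+_) (nat-+ m n)) (sym (ℚ.+-assoc 1ℚ (nat m) (nat n)))

  nat-* : ∀ m n → nat (m ℕ.* n) ≡ nat m ℚ.* nat n
  nat-* zero    n = sym (ℚ.*-zeroˡ (nat n))
  nat-* (suc m) n = trans (nat-+ n (m ℕ.* n)) (trans (cong (nat n ℚ.+_) (nat-* m n))
    (solve 2 (λ m n → n :+ m :* n := (con 1ℚ :+ m) :* n) refl (nat m) (nat n)))

  0≤nat : ∀ n → 0ℚ ℚ.≤ nat n
  0≤nat zero    = ℚ.≤-refl
  0≤nat (suc n) = 0≤+ 0≤1 (0≤nat n)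

  0<nat : ∀ n → 0ℚ ℚ.< nat (suc n)
  0<nat n = 0<+ 0<1 (0≤nat n)

  nat-mono : ∀ {m n} → m ℕ.≤ n → nat m ℚ.≤ nat n
  nat-mono {n = n} ℕ.z≤n = 0≤nat n
  nat-mono (ℕ.s≤s m≤n)   = ℚ.+-monoʳ-≤ 1ℚ (nat-mono m≤n)

  toℚᵘ-nat : ∀ n → toℚᵘ (nat n) ℚᵘ.≃ ℚᵘ.mkℚᵘ (+ n) 0
  toℚᵘ-nat zero    = ℚᵘ.*≡* refl
  toℚᵘ-nat (suc n) = ℚᵘ.≃-trans (ℚ.toℚᵘ-homo-+ 1ℚ (nat n))
    (ℚᵘ.≃-trans (ℚᵘ.+-congʳ (toℚᵘ 1ℚ) (toℚᵘ-nat n))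
      (ℚᵘ.*≡* (cong (λ k → (+ 1 ℤ.+ k) ℤ.* + 1) (ℤ.*-identityʳ (+ n)))))

  archimedean : ∀ ε → 0ℚ ℚ.< ε → ∃[ N ] 1ℚ ℚ.≤ nat (suc N) ℚ.* ε
  archimedean ε@(mkℚ (+ zero) b _)      0<ε = ⊥-elim (ℚ.<-irrefl (sym (ℚ.↥p≡0⇒p≡0 ε refl)) 0<ε)
  archimedean ε@(mkℚ ℤ.-[1+ a ] b _)    0<ε = ⊥-elim (ℚ.<-asym 0<ε (ℚ.negative⁻¹ ε))
  archimedean ε@(mkℚ (+ suc a) b _)     0<ε = b , ℚ.toℚᵘ-cancel-≤
    (ℚᵘ.≤-respʳ-≃ (ℚᵘ.≃-sym (ℚᵘ.≃-trans (ℚ.toℚᵘ-homo-* (nat (suc b)) ε)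
                                        (ℚᵘ.*-congʳ {toℚᵘ ε} (toℚᵘ-nat (suc b)))))
      (ℚᵘ.*≤* (ℤ.+≤+ b+1≤)))
    where
    open ℕ.≤-Reasoning
    b+1≤ : 1 ℕ.* (1 ℕ.* suc b) ℕ.≤ suc b ℕ.* suc a ℕ.* 1
    b+1≤ = begin
      1 ℕ.* (1 ℕ.* suc b)      ≡⟨ trans (ℕ.*-identityˡ _) (ℕ.*-identityˡ _) ⟩
      suc b                    ≤⟨ ℕ.m≤m*n (suc b) (suc a) ⟩
      suc b ℕ.* suc a          ≡⟨ ℕ.*-identityʳ _ ⟨
      suc b ℕ.* suc a ℕ.* 1    ∎

  inv-nat-small : ∀ ε → 0ℚ ℚ.< ε → ∃[ N ] ∀ n → N ℕ.≤ n → inv (nat (suc n)) ℚ.≤ ε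
  inv-nat-small ε 0<ε with archimedean ε 0<ε
  ... | N , 1≤Nε = N , λ n N≤n →
    let v   = inv (nat (suc n))
        0≤v = ℚ.<⇒≤ (inv-pos (0<nat n))
    in subst₂ ℚ._≤_ (ℚ.*-identityʳ v)
         (trans (solve 3 (λ v k ε → v :* (k :* ε) := (k :* v) :* ε) refl v (nat (suc n)) ε)
           (trans (cong (ℚ._* ε) (inv-inverse (0<nat n))) (ℚ.*-identityˡ ε)))
         (*-monoˡ 0≤v (ℚ.≤-trans 1≤Nε (*-monoʳ (ℚ.<⇒≤ 0<ε) (nat-mono (ℕ.s≤s N≤n)))))

  ∑< : ℕ → (ℕ → ℚ) → ℚ
  ∑< zero    g = 0ℚ
  ∑< (suc n) g = g 0 ℚ.+ ∑< n (λ i → g (suc i))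

  ∑<-cong : ∀ n {g h : ℕ → ℚ} → (∀ i → g i ≡ h i) → ∑< n g ≡ ∑< n h
  ∑<-cong zero    g≡h = refl
  ∑<-cong (suc n) g≡h = cong₂ ℚ._+_ (g≡h 0) (∑<-cong n (λ i → g≡h (suc i)))

  ∑<-dist : ∀ n (g h : ℕ → ℚ) c → (∀ i → i ℕ.< n → ∣ g i ℚ.- h i ∣ ℚ.≤ c) →
            ∣ ∑< n g ℚ.- ∑< n h ∣ ℚ.≤ nat n ℚ.* c
  ∑<-dist zero    g h c close = ℚ.≤-reflexive (sym (ℚ.*-zeroˡ c))
  ∑<-dist (suc n) g h c close = subst₂ ℚ._≤_
    (cong ∣_∣ (solve 4 (λ a b s t → (a :- b) :+ (s :- t) := (a :+ s) :- (b :+ t)) refl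
                (g 0) (h 0) (∑< n _) (∑< n _)))
    (solve 2 (λ n c → c :+ n :* c := (con 1ℚ :+ n) :* c) refl (nat n) c)
    (ℚ.≤-trans (ℚ.∣p+q∣≤∣p∣+∣q∣ (g 0 ℚ.- h 0) _)
      (ℚ.+-mono-≤ (close 0 ℕ.z<s) (∑<-dist n _ _ c (λ i i<n → close (suc i) (ℕ.s<s i<n)))))

  ∑<-const : ∀ n c → ∑< n (λ _ → c) ≡ nat n ℚ.* c
  ∑<-const zero    c = sym (ℚ.*-zeroˡ c)
  ∑<-const (suc n) c = trans (cong (c ℚ.+_) (∑<-const n c))
    (solve 2 (λ n c → c :+ n :* c := (con 1ℚ :+ n) :* c) refl (nat n) c)

  ∑<-++ : ∀ m n g → ∑< (m ℕ.+ n) g ≡ ∑< m g ℚ.+ ∑< n (λ i → g (m ℕ.+ i))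
  ∑<-++ zero    n g = sym (ℚ.+-identityˡ _)
  ∑<-++ (suc m) n g = trans (cong (g 0 ℚ.+_) (∑<-++ m n (λ i → g (suc i))))
                            (sym (ℚ.+-assoc (g 0) _ _))

  ∑<-blocks : ∀ n m g → ∑< (n ℕ.* m) g ≡ ∑< n (λ i → ∑< m (λ j → g (i ℕ.* m ℕ.+ j)))
  ∑<-blocks zero    m g = refl
  ∑<-blocks (suc n) m g = trans (∑<-++ m (n ℕ.* m) g) (cong (∑< m g ℚ.+_)
    (trans (∑<-blocks n m (λ i → g (m ℕ.+ i)))
      (∑<-cong n (λ i → ∑<-cong m (λ j → cong g (sym (ℕ.+-assoc m (i ℕ.* m) j)))))))

  -- The left Riemann sum of ∫₁^q dt/t with N equal subintervals.

  width : ℚ → ℕ → ℚ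
  width q N = (q ℚ.- 1ℚ) ℚ.* inv (nat N)

  riemann : ℚ → ℕ → ℚ
  riemann q N = ∑< N (λ i → width q N ℚ.* inv (1ℚ ℚ.+ nat i ℚ.* width q N))

  nat*width : ∀ q n → nat (suc n) ℚ.* width q (suc n) ≡ q ℚ.- 1ℚ
  nat*width q n = trans
    (solve 3 (λ k a v → k :* (a :* v) := a :* (k :* v)) refl
      (nat (suc n)) (q ℚ.- 1ℚ) (inv (nat (suc n))))
    (trans (cong ((q ℚ.- 1ℚ) ℚ.*_) (inv-inverse (0<nat n))) (ℚ.*-identityʳ _))

  node-≥ : ∀ {δ q} n i → δ ℚ.≤ 1ℚ → δ ℚ.≤ q → i ℕ.≤ suc n →
           δ ℚ.≤ 1ℚ ℚ.+ nat i ℚ.* width q (suc n)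
  node-≥ {δ} {q} n i δ≤1 δ≤q i≤N = 0≤-⇒≤ (subst (0ℚ ℚ.≤_)
    (solve 4 (λ i v δ q → (con 1ℚ :- i :* v) :* (con 1ℚ :- δ) :+ (i :* v) :* (q :- δ)
                        := (con 1ℚ :+ i :* ((q :- con 1ℚ) :* v)) :- δ) refl (nat i) v δ q)
    (0≤+ (0≤* (≤⇒0≤- iv≤1) (≤⇒0≤- δ≤1)) (0≤* (0≤* (0≤nat i) 0≤v) (≤⇒0≤- δ≤q))))
    where
    v = inv (nat (suc n))
    0≤v : 0ℚ ℚ.≤ v
    0≤v = ℚ.<⇒≤ (inv-pos (0<nat n))
    iv≤1 : nat i ℚ.* v ℚ.≤ 1ℚ
    iv≤1 = subst (nat i ℚ.* v ℚ.≤_) (inv-inverse (0<nat n)) (*-monoʳ 0≤v (nat-mono i≤N))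

  riemann-lipschitz : ∀ {δ p q} n → 0ℚ ℚ.< δ → δ ℚ.≤ 1ℚ → δ ℚ.≤ p → δ ℚ.≤ q →
    ∣ riemann p (suc n) ℚ.- riemann q (suc n) ∣ ℚ.≤ ∣ p ℚ.- q ∣ ℚ.* (inv δ ℚ.* inv δ)
  riemann-lipschitz {δ} {p} {q} n 0<δ δ≤1 δ≤p δ≤q =
    subst (∣ riemann p (suc n) ℚ.- riemann q (suc n) ∣ ℚ.≤_)
      (trans (sym (ℚ.*-assoc N ∣ h ℚ.- k ∣ D))
        (cong (ℚ._* D) (trans (cong (ℚ._* ∣ h ℚ.- k ∣) (sym (ℚ.0≤p⇒∣p∣≡p (0≤nat (suc n)))))
          (trans (sym (ℚ.∣p*q∣≡∣p∣*∣q∣ N (h ℚ.- k))) (cong ∣_∣ N*diff)))))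
      (∑<-dist (suc n) (λ i → h ℚ.* inv (1ℚ ℚ.+ nat i ℚ.* h)) (λ i → k ℚ.* inv (1ℚ ℚ.+ nat i ℚ.* k))
        (∣ h ℚ.- k ∣ ℚ.* D) term)
    where
    N = nat (suc n)
    D = inv δ ℚ.* inv δ
    h = width p (suc n)
    k = width q (suc n)
    N*diff : N ℚ.* (h ℚ.- k) ≡ p ℚ.- q
    N*diff = trans (solve 3 (λ N h k → N :* (h :- k) := N :* h :- N :* k) refl N h k)
      (trans (cong₂ ℚ._-_ (nat*width p n) (nat*width q n))
        (solve 2 (λ p q → (p :- con 1ℚ) :- (q :- con 1ℚ) := p :- q) refl p q))
    term : ∀ i → i ℕ.< suc n →
      ∣ h ℚ.* inv (1ℚ ℚ.+ nat i ℚ.* h) ℚ.- k ℚ.* inv (1ℚ ℚ.+ nat i ℚ.* k) ∣ ℚ.≤ ∣ h ℚ.- k ∣ ℚ.* D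
    term i i<N = subst (ℚ._≤ ∣ h ℚ.- k ∣ ℚ.* D)
      (sym (trans (cong ∣_∣ diff) (ℚ.∣p*q∣≡∣p∣*∣q∣ (h ℚ.- k) (inv a ℚ.* inv b))))
      (*-monoˡ (ℚ.0≤∣p∣ (h ℚ.- k)) (inv-product 0<δ δ≤a δ≤b))
      where
      a = 1ℚ ℚ.+ nat i ℚ.* h
      b = 1ℚ ℚ.+ nat i ℚ.* k
      δ≤a : δ ℚ.≤ a
      δ≤a = node-≥ n i δ≤1 δ≤p (ℕ.<⇒≤ i<N)
      δ≤b : δ ℚ.≤ b
      δ≤b = node-≥ n i δ≤1 δ≤q (ℕ.<⇒≤ i<N)
      diff : h ℚ.* inv a ℚ.- k ℚ.* inv b ≡ (h ℚ.- k) ℚ.* (inv a ℚ.* inv b)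
      diff = trans
        (cong₂ ℚ._-_ (*-inv-cancel (h ℚ.* inv a) (ℚ.<-≤-trans 0<δ δ≤b))
                     (*-inv-cancel (k ℚ.* inv b) (ℚ.<-≤-trans 0<δ δ≤a)))
        (solve 5 (λ i h k u v →
            (h :* u) :* ((con 1ℚ :+ i :* k) :* v) :- (k :* v) :* ((con 1ℚ :+ i :* h) :* u)
            := (h :- k) :* (u :* v)) refl (nat i) h k (inv a) (inv b))

  -- Splitting each of the N subintervals into M equal parts.

  riemann-refine : ∀ {δ q} n m → 0ℚ ℚ.< δ → δ ℚ.≤ 1ℚ → δ ℚ.≤ q →
    ∣ riemann q (suc n) ℚ.- riemann q (suc n ℕ.* suc m) ∣ ℚ.≤
      (∣ q ℚ.- 1ℚ ∣ ℚ.* ∣ q ℚ.- 1ℚ ∣ ℚ.* (inv δ ℚ.* inv δ)) ℚ.* inv (nat (suc n))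
  riemann-refine {δ} {q} n m 0<δ δ≤1 δ≤q = subst₂ ℚ._≤_
    (cong (λ s → ∣ riemann q (suc n) ℚ.- s ∣) (sym (∑<-blocks (suc n) (suc m) fine)))
    total
    (∑<-dist (suc n) (λ i → h ℚ.* inv (1ℚ ℚ.+ nat i ℚ.* h))
      (λ i → ∑< (suc m) (λ j → fine (i ℕ.* suc m ℕ.+ j)))
      (M ℚ.* (∣ k ∣ ℚ.* (∣ h ∣ ℚ.* D))) block)
    where
    N = nat (suc n)
    M = nat (suc m)
    D = inv δ ℚ.* inv δ
    B = ∣ q ℚ.- 1ℚ ∣
    h = width q (suc n)
    k = width q (suc n ℕ.* suc m)
    fine : ℕ → ℚ
    fine l = k ℚ.* inv (1ℚ ℚ.+ nat l ℚ.* k)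

    NMk : N ℚ.* (M ℚ.* k) ≡ q ℚ.- 1ℚ
    NMk = trans (sym (ℚ.*-assoc N M k))
      (trans (cong (ℚ._* k) (sym (nat-* (suc n) (suc m)))) (nat*width q (m ℕ.+ n ℕ.* suc m)))

    M*k : M ℚ.* k ≡ h
    M*k = trans (sym (ℚ.*-identityˡ (M ℚ.* k)))
      (trans (cong (ℚ._* (M ℚ.* k)) (sym (inv-inverse (0<nat n))))
        (trans (solve 3 (λ N v x → (N :* v) :* x := (N :* x) :* v) refl N (inv N) (M ℚ.* k))
          (cong (ℚ._* inv N) NMk)))

    abs-nat : ∀ j x → ∣ nat j ℚ.* x ∣ ≡ nat j ℚ.* ∣ x ∣
    abs-nat j x = trans (ℚ.∣p*q∣≡∣p∣*∣q∣ (nat j) x) (cong (ℚ._* ∣ x ∣) (ℚ.0≤p⇒∣p∣≡p (0≤nat j)))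

    total : N ℚ.* (M ℚ.* (∣ k ∣ ℚ.* (∣ h ∣ ℚ.* D))) ≡ (B ℚ.* B ℚ.* D) ℚ.* inv N
    total = trans (solve 5 (λ N M k h D → N :* (M :* (k :* (h :* D))) := (N :* (M :* k)) :* h :* D)
                     refl N M ∣ k ∣ ∣ h ∣ D)
      (trans (cong₂ (λ x y → x ℚ.* y ℚ.* D)
               (trans (cong (N ℚ.*_) (sym (abs-nat (suc m) k)))
                 (trans (sym (abs-nat (suc n) (M ℚ.* k))) (cong ∣_∣ NMk)))
               (trans (ℚ.∣p*q∣≡∣p∣*∣q∣ (q ℚ.- 1ℚ) (inv N))
                 (cong (B ℚ.*_) (ℚ.0≤p⇒∣p∣≡p (ℚ.<⇒≤ (inv-pos (0<nat n)))))))
        (solve 3 (λ B v D → B :* (B :* v) :* D := (B :* B :* D) :* v) refl B (inv N) D))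

    block : ∀ i → i ℕ.< suc n →
      ∣ h ℚ.* inv (1ℚ ℚ.+ nat i ℚ.* h) ℚ.- ∑< (suc m) (λ j → fine (i ℕ.* suc m ℕ.+ j)) ∣ ℚ.≤
        M ℚ.* (∣ k ∣ ℚ.* (∣ h ∣ ℚ.* D))
    block i i<N = subst (λ s → ∣ s ℚ.- ∑< (suc m) (λ j → fine (i ℕ.* suc m ℕ.+ j)) ∣ ℚ.≤ _)
      (trans (∑<-const (suc m) (k ℚ.* inv a))
        (trans (sym (ℚ.*-assoc M k (inv a))) (cong (ℚ._* inv a) M*k)))
      (∑<-dist (suc m) (λ _ → k ℚ.* inv a) (λ j → fine (i ℕ.* suc m ℕ.+ j))
        (∣ k ∣ ℚ.* (∣ h ∣ ℚ.* D)) point)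
      where
      a = 1ℚ ℚ.+ nat i ℚ.* h
      δ≤a : δ ℚ.≤ a
      δ≤a = node-≥ n i δ≤1 δ≤q (ℕ.<⇒≤ i<N)
      point : ∀ j → j ℕ.< suc m →
        ∣ k ℚ.* inv a ℚ.- fine (i ℕ.* suc m ℕ.+ j) ∣ ℚ.≤ ∣ k ∣ ℚ.* (∣ h ∣ ℚ.* D)
      point j j<M = subst (ℚ._≤ ∣ k ∣ ℚ.* (∣ h ∣ ℚ.* D))
        (sym (trans (cong ∣_∣ (solve 3 (λ k u v → k :* u :- k :* v := k :* (u :- v)) refl
                                 k (inv a) (inv b)))
                    (ℚ.∣p*q∣≡∣p∣*∣q∣ k (inv a ℚ.- inv b))))
        (*-monoˡ (ℚ.0≤∣p∣ k) (ℚ.≤-trans (inv-dist 0<δ δ≤a δ≤b) (*-monoʳ 0≤D a-b≤h)))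
        where
        b = 1ℚ ℚ.+ nat (i ℕ.* suc m ℕ.+ j) ℚ.* k
        0≤D : 0ℚ ℚ.≤ D
        0≤D = 0≤* (ℚ.<⇒≤ (inv-pos 0<δ)) (ℚ.<⇒≤ (inv-pos 0<δ))
        l≤NM : i ℕ.* suc m ℕ.+ j ℕ.≤ suc n ℕ.* suc m
        l≤NM = ℕ.≤-trans (ℕ.+-monoʳ-≤ (i ℕ.* suc m) (ℕ.<⇒≤ j<M))
          (subst (ℕ._≤ suc n ℕ.* suc m) (ℕ.+-comm (suc m) (i ℕ.* suc m))
            (ℕ.*-monoˡ-≤ (suc m) i<N))
        δ≤b : δ ℚ.≤ b
        δ≤b = node-≥ (m ℕ.+ n ℕ.* suc m) (i ℕ.* suc m ℕ.+ j) δ≤1 δ≤q l≤NM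
        a-b : a ℚ.- b ≡ ℚ.- (nat j ℚ.* k)
        a-b = trans (cong₂ (λ x y → (1ℚ ℚ.+ nat i ℚ.* x) ℚ.- (1ℚ ℚ.+ y ℚ.* k)) (sym M*k)
                      (trans (nat-+ (i ℕ.* suc m) j) (cong (ℚ._+ nat j) (nat-* i (suc m)))))
          (solve 4 (λ i M j k → (con 1ℚ :+ i :* (M :* k)) :- (con 1ℚ :+ (i :* M :+ j) :* k)
                              := :- (j :* k)) refl (nat i) M (nat j) k)
        a-b≤h : ∣ a ℚ.- b ∣ ℚ.≤ ∣ h ∣
        a-b≤h = subst₂ ℚ._≤_
          (sym (trans (cong ∣_∣ a-b) (trans (ℚ.∣-p∣≡∣p∣ (nat j ℚ.* k)) (abs-nat j k))))
          (trans (sym (abs-nat (suc m) k)) (cong ∣_∣ M*k))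
          (*-monoʳ (ℚ.0≤∣p∣ k) (nat-mono (ℕ.<⇒≤ j<M)))

module CauchyProofs where

  open +-*-Solver
  open RationalFacts

  Cauchy : (ℕ → ℚ) → Set
  Cauchy s = ∀ ε → 0ℚ ℚ.< ε →
             ∃[ N ] ∀ m n → N ℕ.≤ m → N ℕ.≤ n → ∣ s m ℚ.- s n ∣ ℚ.≤ ε

  EventuallyBoundedBy : ℚ → (ℕ → ℚ) → Set
  EventuallyBoundedBy B s = ∃[ N ] ∀ n → N ℕ.≤ n → ∣ s n ∣ ℚ.≤ B

  EventuallyAbove : ℚ → (ℕ → ℚ) → Set
  EventuallyAbove δ s = ∃[ N ] ∀ n → N ℕ.≤ n → δ ℚ.≤ s n

  rescale : ∀ s K → 0ℚ ℚ.≤ K →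
    (∀ ε → 0ℚ ℚ.< ε → ∃[ N ] ∀ m n → N ℕ.≤ m → N ℕ.≤ n → ∣ s m ℚ.- s n ∣ ℚ.≤ K ℚ.* ε) →
    Cauchy s
  rescale s K 0≤K close ε 0<ε = proj₁ c , λ m n N≤m N≤n →
    ℚ.≤-trans (proj₂ c m n N≤m N≤n) Kε′≤ε
    where
    v = inv (1ℚ ℚ.+ K)
    0<1+K : 0ℚ ℚ.< 1ℚ ℚ.+ K
    0<1+K = 0<+ 0<1 0≤K
    0<vε : 0ℚ ℚ.< v ℚ.* ε
    0<vε = 0<* (inv-pos 0<1+K) 0<ε
    c = close (v ℚ.* ε) 0<vε
    Kε′≤ε : K ℚ.* (v ℚ.* ε) ℚ.≤ ε
    Kε′≤ε = subst (K ℚ.* (v ℚ.* ε) ℚ.≤_)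
      (trans (sym (ℚ.*-assoc (1ℚ ℚ.+ K) v ε))
        (trans (cong (ℚ._* ε) (inv-inverse 0<1+K)) (ℚ.*-identityˡ ε)))
      (*-monoʳ (ℚ.<⇒≤ 0<vε) (subst (ℚ._≤ 1ℚ ℚ.+ K) (ℚ.+-identityˡ K) (ℚ.+-monoˡ-≤ K 0≤1)))

  bounded : ∀ s → Cauchy s → ∃[ B ] 0ℚ ℚ.≤ B × EventuallyBoundedBy B s
  bounded s c with c 1ℚ 0<1
  ... | N , close = 1ℚ ℚ.+ ∣ s N ∣ , 0≤+ 0≤1 (ℚ.0≤∣p∣ (s N)) , N , λ n N≤n →
    ℚ.≤-trans
      (subst (ℚ._≤ ∣ s n ℚ.- s N ∣ ℚ.+ ∣ s N ∣)
        (cong ∣_∣ (solve 2 (λ a b → (a :- b) :+ b := a) refl (s n) (s N)))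
        (ℚ.∣p+q∣≤∣p∣+∣q∣ (s n ℚ.- s N) (s N)))
      (ℚ.+-monoˡ-≤ ∣ s N ∣ (close n N N≤n ℕ.≤-refl))

  ⊔⁴-≤ : ∀ M N P Q {l} → (M ℕ.⊔ N) ℕ.⊔ (P ℕ.⊔ Q) ℕ.≤ l → M ℕ.≤ l × N ℕ.≤ l × P ℕ.≤ l × Q ℕ.≤ l
  ⊔⁴-≤ M N P Q L≤l = ℕ.m⊔n≤o⇒m≤o M N MN , ℕ.m⊔n≤o⇒n≤o M N MN , ℕ.m⊔n≤o⇒m≤o P Q PQ , ℕ.m⊔n≤o⇒n≤o P Q PQ
    where
    MN = ℕ.m⊔n≤o⇒m≤o (M ℕ.⊔ N) (P ℕ.⊔ Q) L≤l
    PQ = ℕ.m⊔n≤o⇒n≤o (M ℕ.⊔ N) (P ℕ.⊔ Q) L≤l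

  const-cauchy : ∀ q → Cauchy (λ _ → q)
  const-cauchy q ε 0<ε = 0 , λ _ _ _ _ →
    subst (ℚ._≤ ε) (sym (cong ∣_∣ (ℚ.+-inverseʳ q))) (ℚ.<⇒≤ 0<ε)

  neg-cauchy : ∀ s → Cauchy s → Cauchy (λ n → ℚ.- s n)
  neg-cauchy s c ε 0<ε with c ε 0<ε
  ... | N , close = N , λ m n N≤m N≤n → subst (ℚ._≤ ε)
    (trans (∣a-b∣≡∣b-a∣ (s m) (s n))
      (cong ∣_∣ (solve 2 (λ a b → b :- a := (:- a) :- (:- b)) refl (s m) (s n))))
    (close m n N≤m N≤n)

  +-cauchy : ∀ s t → Cauchy s → Cauchy t → Cauchy (λ n → s n ℚ.+ t n)
  +-cauchy s t c d = rescale (λ n → s n ℚ.+ t n) (1ℚ ℚ.+ 1ℚ) (0≤+ 0≤1 0≤1) close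
    where
    close : ∀ ε → 0ℚ ℚ.< ε → ∃[ N ] ∀ m n → N ℕ.≤ m → N ℕ.≤ n →
            ∣ (s m ℚ.+ t m) ℚ.- (s n ℚ.+ t n) ∣ ℚ.≤ (1ℚ ℚ.+ 1ℚ) ℚ.* ε
    close ε 0<ε with c ε 0<ε | d ε 0<ε
    ... | M , p | N , q = M ℕ.⊔ N , λ m n N≤m N≤n → subst₂ ℚ._≤_
      (cong ∣_∣ (solve 4 (λ a b c d → (a :- c) :+ (b :- d) := (a :+ b) :- (c :+ d)) refl
                  (s m) (t m) (s n) (t n)))
      (solve 1 (λ e → e :+ e := (con 1ℚ :+ con 1ℚ) :* e) refl ε)
      (ℚ.≤-trans (ℚ.∣p+q∣≤∣p∣+∣q∣ (s m ℚ.- s n) (t m ℚ.- t n))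
        (ℚ.+-mono-≤
          (p m n (ℕ.m⊔n≤o⇒m≤o M N N≤m) (ℕ.m⊔n≤o⇒m≤o M N N≤n))
          (q m n (ℕ.m⊔n≤o⇒n≤o M N N≤m) (ℕ.m⊔n≤o⇒n≤o M N N≤n))))

  *-cauchy : ∀ s t → Cauchy s → Cauchy t → Cauchy (λ n → s n ℚ.* t n)
  *-cauchy s t c d = go (bounded s c) (bounded t d)
    where
    go : (∃[ A ] 0ℚ ℚ.≤ A × EventuallyBoundedBy A s) →
         (∃[ B ] 0ℚ ℚ.≤ B × EventuallyBoundedBy B t) → Cauchy (λ n → s n ℚ.* t n)
    go (A , 0≤A , M , s≤A) (B , 0≤B , N , t≤B) =
      rescale (λ n → s n ℚ.* t n) (B ℚ.+ A) (0≤+ {B} {A} 0≤B 0≤A) λ ε 0<ε →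
        let P , p = c ε 0<ε
            Q , q = d ε 0<ε
        in (M ℕ.⊔ N) ℕ.⊔ (P ℕ.⊔ Q) , λ m n L≤m L≤n →
          let M≤m , N≤m , P≤m , Q≤m = ⊔⁴-≤ M N P Q L≤m
              M≤n , N≤n , P≤n , Q≤n = ⊔⁴-≤ M N P Q L≤n
          in product-close (s m) (t m) (s n) (t n) {A} {B} {ε} 0≤A 0≤B
               (t≤B m N≤m) (s≤A n M≤n) (p m n P≤m P≤n) (q m n Q≤m Q≤n)

  inv-cauchy : ∀ s {δ} → Cauchy s → 0ℚ ℚ.< δ → EventuallyAbove δ s → Cauchy (λ n → inv (s n))
  inv-cauchy s {δ} c 0<δ (M , δ≤s) = rescale (λ n → inv (s n)) D 0≤D close
    where
    D = inv δ ℚ.* inv δ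
    0≤D : 0ℚ ℚ.≤ D
    0≤D = 0≤* (ℚ.<⇒≤ (inv-pos 0<δ)) (ℚ.<⇒≤ (inv-pos 0<δ))
    close : ∀ ε → 0ℚ ℚ.< ε → ∃[ L ] ∀ m n → L ℕ.≤ m → L ℕ.≤ n →
            ∣ inv (s m) ℚ.- inv (s n) ∣ ℚ.≤ D ℚ.* ε
    close ε 0<ε with c ε 0<ε
    ... | N , p = M ℕ.⊔ N , λ m n L≤m L≤n → ℚ.≤-trans
      (inv-dist 0<δ (δ≤s m (ℕ.m⊔n≤o⇒m≤o M N L≤m)) (δ≤s n (ℕ.m⊔n≤o⇒m≤o M N L≤n)))
      (subst (ℚ._≤ D ℚ.* ε) (ℚ.*-comm D ∣ s m ℚ.- s n ∣)
        (*-monoˡ 0≤D (p m n (ℕ.m⊔n≤o⇒n≤o M N L≤m) (ℕ.m⊔n≤o⇒n≤o M N L≤n))))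

  ln-cauchy : ∀ s {δ} → Cauchy s → 0ℚ ℚ.< δ → EventuallyAbove δ s →
              Cauchy (λ n → riemann (s n) (suc n))
  ln-cauchy s {η} c 0<η (M , η≤s) = go (bounded s c)
    where
    δ = η ℚ.⊓ 1ℚ
    0<δ : 0ℚ ℚ.< δ
    0<δ with ℚ.≤-total η 1ℚ
    ... | inj₁ η≤1 = subst (0ℚ ℚ.<_) (sym (ℚ.p≤q⇒p⊓q≡p η≤1)) 0<η
    ... | inj₂ 1≤η = subst (0ℚ ℚ.<_) (sym (ℚ.p≥q⇒p⊓q≡q 1≤η)) 0<1
    δ≤1 : δ ℚ.≤ 1ℚ
    δ≤1 = ℚ.p⊓q≤q η 1ℚ
    D = inv δ ℚ.* inv δ
    0≤D : 0ℚ ℚ.≤ D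
    0≤D = 0≤* (ℚ.<⇒≤ (inv-pos 0<δ)) (ℚ.<⇒≤ (inv-pos 0<δ))

    δ≤s : ∀ n → M ℕ.≤ n → δ ℚ.≤ s n
    δ≤s n M≤n = ℚ.≤-trans (ℚ.p⊓q≤p η 1ℚ) (η≤s n M≤n)

    refine : ∀ {B ε} k l → 0ℚ ℚ.≤ B → ∣ s k ℚ.- 1ℚ ∣ ℚ.≤ B → M ℕ.≤ k → inv (nat (suc k)) ℚ.≤ ε →
             ∣ riemann (s k) (suc k) ℚ.- riemann (s k) (suc k ℕ.* suc l) ∣ ℚ.≤ (B ℚ.* B ℚ.* D) ℚ.* ε
    refine {B} k l 0≤B s-1≤B M≤k small = ℚ.≤-trans
      (riemann-refine k l 0<δ δ≤1 (δ≤s k M≤k))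
      (*-mono (0≤* (0≤* 0≤B 0≤B) 0≤D) (ℚ.<⇒≤ (inv-pos (0<nat k)))
        (*-monoʳ 0≤D (*-mono 0≤B (ℚ.0≤∣p∣ (s k ℚ.- 1ℚ)) s-1≤B s-1≤B))
        small)

    compare : ∀ {B ε} m n → 0ℚ ℚ.≤ B → M ℕ.≤ m → M ℕ.≤ n →
      ∣ s m ℚ.- 1ℚ ∣ ℚ.≤ B → ∣ s n ℚ.- 1ℚ ∣ ℚ.≤ B →
      inv (nat (suc m)) ℚ.≤ ε → inv (nat (suc n)) ℚ.≤ ε → ∣ s m ℚ.- s n ∣ ℚ.≤ ε →
      ∣ riemann (s m) (suc m) ℚ.- riemann (s n) (suc n) ∣ ℚ.≤
        (B ℚ.* B ℚ.* D ℚ.+ (D ℚ.+ B ℚ.* B ℚ.* D)) ℚ.* ε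
    compare {B} {ε} m n 0≤B M≤m M≤n m≤B n≤B m-small n-small close =
      subst (∣ a ℚ.- d ∣ ℚ.≤_)
        (solve 3 (λ C D e → C :* e :+ (D :* e :+ C :* e) := (C :+ (D :+ C)) :* e) refl
          (B ℚ.* B ℚ.* D) D ε)
        (ℚ.≤-trans (triangle a b d)
          (ℚ.+-mono-≤ (refine m n 0≤B m≤B M≤m m-small)
            (ℚ.≤-trans (triangle b b′ d) (ℚ.+-mono-≤ bb′ b′d))))
      where
      a  = riemann (s m) (suc m)
      b  = riemann (s m) (suc m ℕ.* suc n)
      b′ = riemann (s n) (suc m ℕ.* suc n)
      d  = riemann (s n) (suc n)
      bb′ : ∣ b ℚ.- b′ ∣ ℚ.≤ D ℚ.* ε
      bb′ = ℚ.≤-trans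
        (riemann-lipschitz (n ℕ.+ m ℕ.* suc n) 0<δ δ≤1 (δ≤s m M≤m) (δ≤s n M≤n))
        (subst (ℚ._≤ D ℚ.* ε) (ℚ.*-comm D ∣ s m ℚ.- s n ∣) (*-monoˡ 0≤D close))
      b′d : ∣ b′ ℚ.- d ∣ ℚ.≤ (B ℚ.* B ℚ.* D) ℚ.* ε
      b′d = subst (ℚ._≤ (B ℚ.* B ℚ.* D) ℚ.* ε)
        (trans (cong (λ k → ∣ d ℚ.- riemann (s n) k ∣) (ℕ.*-comm (suc n) (suc m)))
               (∣a-b∣≡∣b-a∣ d b′))
        (refine n m 0≤B n≤B M≤n n-small)

    go : (∃[ A ] 0ℚ ℚ.≤ A × EventuallyBoundedBy A s) → Cauchy (λ n → riemann (s n) (suc n))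
    go (A , 0≤A , N , s≤A) =
      rescale (λ n → riemann (s n) (suc n)) (C ℚ.+ (D ℚ.+ C))
        (0≤+ {C} {D ℚ.+ C} 0≤C (0≤+ {D} {C} 0≤D 0≤C)) λ ε 0<ε →
          let P , p = c ε 0<ε
              Q , q = inv-nat-small ε 0<ε
          in (M ℕ.⊔ N) ℕ.⊔ (P ℕ.⊔ Q) , λ m n L≤m L≤n →
            let M≤m , N≤m , P≤m , Q≤m = ⊔⁴-≤ M N P Q L≤m
                M≤n , N≤n , P≤n , Q≤n = ⊔⁴-≤ M N P Q L≤n
            in compare {B} {ε} m n 0≤B M≤m M≤n (s-1≤B m N≤m) (s-1≤B n N≤n)
                 (q m Q≤m) (q n Q≤n) (p m n P≤m P≤n)
      where
      B = A ℚ.+ 1ℚ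
      C = B ℚ.* B ℚ.* D
      0≤B : 0ℚ ℚ.≤ B
      0≤B = 0≤+ 0≤A 0≤1
      0≤C : 0ℚ ℚ.≤ C
      0≤C = 0≤* (0≤* 0≤B 0≤B) 0≤D
      s-1≤B : ∀ n → N ℕ.≤ n → ∣ s n ℚ.- 1ℚ ∣ ℚ.≤ B
      s-1≤B n N≤n = ℚ.≤-trans (ℚ.∣p-q∣≤∣p∣+∣q∣ (s n) 1ℚ) (ℚ.+-monoˡ-≤ 1ℚ (s≤A n N≤n))

open RationalFacts using (nat; inv; riemann)
open CauchyProofs using (Cauchy; EventuallyAbove)

-- Sealed so that normalising a real number never unfolds its modulus of convergence.
module CauchyFacts where

  abstract

    const-cauchy : ∀ q → Cauchy (λ _ → q)
    const-cauchy = CauchyProofs.const-cauchy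

    neg-cauchy : ∀ s → Cauchy s → Cauchy (λ n → ℚ.- s n)
    neg-cauchy = CauchyProofs.neg-cauchy

    +-cauchy : ∀ s t → Cauchy s → Cauchy t → Cauchy (λ n → s n ℚ.+ t n)
    +-cauchy = CauchyProofs.+-cauchy

    *-cauchy : ∀ s t → Cauchy s → Cauchy t → Cauchy (λ n → s n ℚ.* t n)
    *-cauchy = CauchyProofs.*-cauchy

    inv-cauchy : ∀ s {δ} → Cauchy s → 0ℚ ℚ.< δ → EventuallyAbove δ s → Cauchy (λ n → inv (s n))
    inv-cauchy = CauchyProofs.inv-cauchy

    ln-cauchy : ∀ s {δ} → Cauchy s → 0ℚ ℚ.< δ → EventuallyAbove δ s →
                Cauchy (λ n → riemann (s n) (suc n))
    ln-cauchy = CauchyProofs.ln-cauchy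

-- Cauchy reals with an explicit modulus of convergence. Two sequences with the
-- same limit are identified only by _≃_, not by _≡_.
record ℝ : Set where
  constructor mkℝ
  field
    seq    : ℕ → ℚ
    cauchy : Cauchy seq

open ℝ public

infix  4 _≤_ _<_ _≃_
infixl 6 _+_ _-_
infixl 7 _*_ _÷_[_]
infixr 8 _^_ -_

_≤_ : ℝ → ℝ → Set
x ≤ y = ∀ ε → 0ℚ ℚ.< ε → ∃[ N ] ∀ n → N ℕ.≤ n → seq x n ℚ.≤ seq y n ℚ.+ ε

_<_ : ℝ → ℝ → Set
x < y = ∃[ ε ] 0ℚ ℚ.< ε × ∃[ N ] (∀ n → N ℕ.≤ n → seq x n ℚ.+ ε ℚ.≤ seq y n)

_≃_ : ℝ → ℝ → Set
x ≃ y = x ≤ y × y ≤ x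

fromℚ : ℚ → ℝ
fromℚ q = mkℝ (λ _ → q) (CauchyFacts.const-cauchy q)

fromℕ : ℕ → ℝ
fromℕ n = fromℚ (nat n)

0ℝ 1ℝ : ℝ
0ℝ = fromℚ 0ℚ
1ℝ = fromℚ 1ℚ

-_ : ℝ → ℝ
-_ x = mkℝ (λ n → ℚ.- seq x n) (CauchyFacts.neg-cauchy (seq x) (cauchy x))

_+_ _*_ _-_ : ℝ → ℝ → ℝ
x + y = mkℝ (λ n → seq x n ℚ.+ seq y n) (CauchyFacts.+-cauchy (seq x) (seq y) (cauchy x) (cauchy y))
x * y = mkℝ (λ n → seq x n ℚ.* seq y n) (CauchyFacts.*-cauchy (seq x) (seq y) (cauchy x) (cauchy y))
x - y = x + (- y)

_^_ : ℝ → ℕ → ℝ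
x ^ zero  = 1ℝ
x ^ suc n = x * x ^ n

positive⇒above : ∀ {x} (0<x : 0ℝ < x) → EventuallyAbove (proj₁ 0<x) (seq x)
positive⇒above {x} (ε , _ , N , above) =
  N , λ n N≤n → subst (ℚ._≤ seq x n) (ℚ.+-identityˡ ε) (above n N≤n)

_÷_[_] : ℝ → (y : ℝ) → 0ℝ < y → ℝ
x ÷ y [ 0<y ] = x * mkℝ (λ n → inv (seq y n))
  (CauchyFacts.inv-cauchy (seq y) (cauchy y) (proj₁ (proj₂ 0<y)) (positive⇒above {y} 0<y))

-- ln x = ∫₁ˣ dt/t. If x₀, x₁, … represents x, the n-th approximation is the left
-- Riemann sum of ∫₁^{xₙ} dt/t with n + 1 equal (oriented) subintervals.
ln : (x : ℝ) → 0ℝ < x → ℝ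
ln x 0<x = mkℝ (λ n → riemann (seq x n) (suc n))
  (CauchyFacts.ln-cauchy (seq x) (cauchy x) (proj₁ (proj₂ 0<x)) (positive⇒above {x} 0<x))

∑ : ∀ {A : Set} → List A → (A → ℝ) → ℝ
∑ xs g = foldr (λ x s → g x + s) 0ℝ xs

IsRational : ℝ → Set
IsRational x = ∃[ q ] x ≃ fromℚ q

IsInfimum : (ℝ → Set) → ℝ → Set
IsInfimum P m = (∀ y → P y → m ≤ y) × (∀ b → (∀ y → P y → b ≤ y) → b ≤ m)

x<y⇒0<y-x : ∀ {x y} → x < y → 0ℝ < y - x
x<y⇒0<y-x {x} {y} (ε , 0<ε , N , above) = ε , 0<ε , N , λ n N≤n →
  subst (ℚ._≤ seq y n ℚ.- seq x n)
    (+-*-Solver.solve 2 (λ a e → (a :+ e) :- a := con 0ℚ :+ e) refl (seq x n) ε)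
    (ℚ.+-monoˡ-≤ (ℚ.- seq x n) (above n N≤n))
  where open +-*-Solver using (_:+_; _:-_; _:=_; con)

fromℕ-positive : ∀ {n} → 1 ℕ.≤ n → 0ℝ < fromℕ n
fromℕ-positive 1≤n = 1ℚ , RationalFacts.0<1 , 0 , λ _ _ → RationalFacts.nat-mono 1≤n

-- A hypergraph on the vertex set Fin n; the family of edges is a duplicate-free list.
record Hypergraph (n : ℕ) : Set where
  field
    edges          : List (Subset n)
    edges-unique   : Unique edges
    edges-nonempty : ∃[ F ] F ∈ edges
    edge-nonempty  : ∀ {F} → F ∈ edges → Nonempty F

module _ {n : ℕ} (H : Hypergraph n) where

  open Hypergraph H

  degree : Fin n → ℕ
  degree x = length (filter (x ∈ˢ?_) edges)

  Δ : ℕ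
  Δ = max 0 (map degree (allFin n))

  1≤Δ : 1 ℕ.≤ Δ
  1≤Δ with edges-nonempty
  ... | F , F∈ with edge-nonempty F∈
  ... | x , x∈F = ℕ.≤-trans (1≤length (∈-filter⁺ (x ∈ˢ?_) F∈ x∈F))
    (All.lookup (xs≤max 0 (map degree (allFin n))) (∈-map⁺ degree (∈-allFin x)))
    where
    1≤length : ∀ {A : Set} {y : A} {ys} → y ∈ ys → 1 ℕ.≤ length ys
    1≤length (here _)  = ℕ.s≤s ℕ.z≤n
    1≤length (there _) = ℕ.s≤s ℕ.z≤n

  -- A multiset of vertices is a list whose order is irrelevant; its cardinality
  -- is its length.
  Multiset : Set
  Multiset = List (Fin n)

  hits : Multiset → Subset n → ℕ
  hits A F = length (filter (_∈ˢ? F) A)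

  IsTransversal : ℕ → Multiset → Set
  IsTransversal f A = ∀ {F} → F ∈ edges → f ℕ.≤ hits A F

  IsTransversalNumber : ℕ → ℕ → Set
  IsTransversalNumber f t =
    (∃[ A ] IsTransversal f A × length A ≡ t) × (∀ A → IsTransversal f A → t ℕ.≤ length A)

  IsFractionalTransversal : (Fin n → ℝ) → Set
  IsFractionalTransversal w =
    (∀ x → 0ℝ ≤ w x × w x ≤ 1ℝ) ×
    (∀ {F} → F ∈ edges → 1ℝ ≤ ∑ (filter (_∈ˢ? F) (allFin n)) w)

  IsFractionalTransversalNumber : ℝ → Set
  IsFractionalTransversalNumber =
    IsInfimum (λ y → ∃[ w ] IsFractionalTransversal w × y ≃ ∑ (allFin n) w)

  module Greedy (lam : ℝ) (f : ℕ) where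

    value : Multiset → Fin n → ℝ
    value A x = ∑ (filter (λ F → (x ∈ˢ? F) ×-dec (hits A F ℕ.<? f)) edges) (λ F → lam ^ hits A F)

    IsGreedyChoice : Multiset → Fin n → Set
    IsGreedyChoice A x = ∀ y → value A y ≤ value A x

    -- GreedyYields P A: started with the vertices of A already picked, the
    -- algorithm never gets stuck, stops after finitely many steps however ties
    -- are broken, and every possible output satisfies P. (The stopping criterion
    -- k(F) ≥ f for all F is literally IsTransversal f.)
    data GreedyYields (P : Multiset → Set) (A : Multiset) : Set where
      stop : IsTransversal f A → P A → GreedyYields P A
      pick : ¬ IsTransversal f A →
             ∃[ x ] IsGreedyChoice A x →
             (∀ x → IsGreedyChoice A x → GreedyYields P (x ∷ A)) →
             GreedyYields P A

{-# OPTIONS --safe #-}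

-- Let v₁, …, v_T be the values of the vertices picked by the greedy algorithm, Φᵢ the
-- total value still to be collected after i picks, and C = 1 + λ + … + λ^(f-1).
-- Weighting the vertices with a fractional transversal of total W shows Φᵢ₋₁ ≤ K vᵢ
-- with K = C W, and the vᵢ decrease from at most Δ to at least λ^(f-1). Hence, by
-- summation by parts,
--   T = Σ (Φᵢ₋₁ - Φᵢ) / vᵢ ≤ K (1 + Σ (1 - vᵢ / vᵢ₋₁)) ≤ K (1 + ln (v₁ / v_T)).
-- For rational λ the algorithm is decidable and ln may be replaced by any Riemann
-- upper sum, so the argument is carried out in ℚ. For real λ it is applied to the
-- rational approximations of λ, which suffices as τ_f is fixed; the Riemann sums
-- then become ln in the limit. For λ equal to a rational q the algorithm is run with
-- q, and the bound is transported to λ by continuity.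

module Submission where

open import Defs
open import Data.Empty using (⊥-elim)
open import Data.Fin.Base using (Fin)
open import Data.Fin.Subset using (Subset; Nonempty) renaming (_∈_ to _∈ˢ_)
open import Data.Fin.Subset.Properties using () renaming (_∈?_ to _∈ˢ?_)
open import Data.List.Base using (List; []; _∷_; length; filter; map; allFin)
import Data.List.Extrema as Extrema
open import Data.List.Extrema.Nat using (xs≤max)
open import Data.List.Membership.Propositional using (_∈_; find)
open import Data.List.Membership.Propositional.Properties using (∈-filter⁺; ∈-map⁺; ∈-allFin)
open import Data.List.Properties using (filter-accept; filter-reject)
open import Data.List.Relation.Unary.All as All using ()
open import Data.List.Relation.Unary.All.Properties using (¬All⇒Any¬)
open import Data.List.Relation.Unary.Any using (here; there)
open import Data.Nat.Base as ℕ using (ℕ; zero; suc)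
import Data.Nat.Properties as ℕ
open import Data.Product using (∃-syntax; _×_; _,_; proj₁; proj₂)
open import Data.Rational.Base as ℚ using (ℚ; 0ℚ; 1ℚ; ½; ∣_∣)
import Data.Rational.Properties as ℚ
open import Data.Rational.Solver using (module +-*-Solver)
open import Data.Sum.Base using (inj₁; inj₂)
open import Relation.Binary.Bundles using (DecTotalOrder)
open import Relation.Binary.PropositionalEquality
  using (_≡_; refl; sym; trans; cong; cong₂; subst; subst₂)
open import Relation.Nullary using (¬_; Dec; yes; no)
open import Relation.Nullary.Decidable using (_×-dec_)
open import Relation.Unary using (Decidable)

open RationalFacts
open CauchyProofs using (bounded)
open Extrema (DecTotalOrder.totalOrder ℚ.≤-decTotalOrder) using (argmax; f[xs]≤f[argmax])
open +-*-Solver using (solve; _:+_; _:*_; _:-_; :-_; _:=_; con)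

-- Upper bounds for logarithms

pow : ℚ → ℕ → ℚ
pow q zero    = 1ℚ
pow q (suc k) = q ℚ.* pow q k

pow-pos : ∀ {q} → 0ℚ ℚ.< q → ∀ k → 0ℚ ℚ.< pow q k
pow-pos 0<q zero    = 0<1
pow-pos 0<q (suc k) = 0<* 0<q (pow-pos 0<q k)

pow-step : ∀ {q} → 0ℚ ℚ.< q → q ℚ.≤ 1ℚ → ∀ k → pow q (suc k) ℚ.≤ pow q k
pow-step {q} 0<q q≤1 k = subst (pow q (suc k) ℚ.≤_) (ℚ.*-identityˡ _)
  (*-monoʳ (ℚ.<⇒≤ (pow-pos 0<q k)) q≤1)

pow-antitone : ∀ {q} → 0ℚ ℚ.< q → q ℚ.≤ 1ℚ → ∀ {j k} → j ℕ.≤ k → pow q k ℚ.≤ pow q j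
pow-antitone {q} 0<q q≤1 j≤k = go (ℕ.≤⇒≤′ j≤k)
  where
  go : ∀ {j k} → j ℕ.≤′ k → pow q k ℚ.≤ pow q j
  go (ℕ.≤′-reflexive refl) = ℚ.≤-refl
  go {k = suc k} (ℕ.≤′-step j≤k) = ℚ.≤-trans (pow-step 0<q q≤1 k) (go j≤k)

pow≤1 : ∀ {q} → 0ℚ ℚ.< q → q ℚ.≤ 1ℚ → ∀ k → pow q k ℚ.≤ 1ℚ
pow≤1 0<q q≤1 k = pow-antitone 0<q q≤1 {0} {k} ℕ.z≤n

≤-cancelˡ : ∀ {r p q} → 0ℚ ℚ.< r → r ℚ.* p ℚ.≤ r ℚ.* q → p ℚ.≤ q
≤-cancelˡ {r} 0<r = ℚ.*-cancelˡ-≤-pos r {{ℚ.positive 0<r}}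

*-inv-cancelʳ : ∀ a {b} → 0ℚ ℚ.< b → a ℚ.* b ℚ.* inv b ≡ a
*-inv-cancelʳ a {b} 0<b = trans (ℚ.*-assoc a b (inv b)) (sym (*-inv-cancel a 0<b))

*-inv-cancelʳ′ : ∀ a {b} → 0ℚ ℚ.< b → a ℚ.* inv b ℚ.* b ≡ a
*-inv-cancelʳ′ a {b} 0<b = trans
  (solve 3 (λ a b v → a :* v :* b := a :* b :* v) refl a b (inv b)) (*-inv-cancelʳ a 0<b)

-- Certifies the upper bound c for ln (u / l): the inequality a - b ≤ a ln (a / b)
-- is the only property of the logarithm that the analysis of the algorithm uses,
-- and a piecewise linear function can have it too.
record LogBound (l u c : ℚ) : Set where
  field
    log   : ℚ → ℚ
    slope : ∀ {a b} → l ℚ.≤ b → b ℚ.≤ a → a ℚ.≤ u → a ℚ.- b ℚ.≤ a ℚ.* (log a ℚ.- log b)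
    total : log u ℚ.- log l ℚ.≤ c

  -- Since `a - b` is nonnegative and `a` positive, `slope` leaves no room for `log` to decrease.
  log-mono : 0ℚ ℚ.< l → ∀ {a b} → l ℚ.≤ b → b ℚ.≤ a → a ℚ.≤ u → log b ℚ.≤ log a
  log-mono 0<l {a} {b} l≤b b≤a a≤u = 0≤-⇒≤ (≤-cancelˡ {a}
    (ℚ.<-≤-trans 0<l (ℚ.≤-trans l≤b b≤a))
    (subst (ℚ._≤ a ℚ.* (log a ℚ.- log b)) (sym (ℚ.*-zeroʳ a))
      (ℚ.≤-trans (≤⇒0≤- b≤a) (slope l≤b b≤a a≤u))))

weaken : ∀ {l u c d} → c ℚ.≤ d → LogBound l u c → LogBound l u d
weaken c≤d L = record { log = log ; slope = slope ; total = ℚ.≤-trans total c≤d }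
  where open LogBound L

-- The certificate is `v / l`: its increment from `b` to `a`, multiplied by `a`, is
-- `(a - b) * (a / l)`, and `a / l` is at least 1.
linear : ∀ {l u} → 0ℚ ℚ.< l → LogBound l u ((u ℚ.- l) ℚ.* inv l)
linear {l} {u} 0<l = record
  { log   = ℚ._* inv l
  ; slope = λ {a} {b} l≤b b≤a a≤u → subst₂ ℚ._≤_
      (ℚ.*-identityʳ (a ℚ.- b))
      (solve 3 (λ a b v → (a :- b) :* (a :* v) := a :* (a :* v :- b :* v)) refl a b (inv l))
      (*-monoˡ (≤⇒0≤- b≤a) (subst (ℚ._≤ a ℚ.* inv l) (inv-inverse 0<l)
        (*-monoʳ (ℚ.<⇒≤ (inv-pos 0<l)) (ℚ.≤-trans l≤b b≤a))))
  ; total = ℚ.≤-reflexive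
      (solve 3 (λ l u v → u :* v :- l :* v := (u :- l) :* v) refl l u (inv l))
  }

-- Clamping the argument at `m` from either side glues the two functions together without a case
-- distinction in the definition.
concat : ∀ {l m u c d} → 0ℚ ℚ.< l → l ℚ.≤ m → m ℚ.≤ u →
         LogBound l m c → LogBound m u d → LogBound l u (c ℚ.+ d)
concat {l} {m} {u} {c} {d} 0<l l≤m m≤u L M = record
  { log   = λ v → L.log (v ℚ.⊓ m) ℚ.+ M.log (v ℚ.⊔ m)
  ; slope = slope
  ; total = subst (ℚ._≤ c ℚ.+ d) total-split (ℚ.+-mono-≤ L.total M.total)
  }
  where
  module L = LogBound L
  module M = LogBound M
  log : ℚ → ℚ
  log v = L.log (v ℚ.⊓ m) ℚ.+ M.log (v ℚ.⊔ m)

  log-low : ∀ {v} → v ℚ.≤ m → log v ≡ L.log v ℚ.+ M.log m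
  log-low v≤m = cong₂ (λ x y → L.log x ℚ.+ M.log y) (ℚ.p≤q⇒p⊓q≡p v≤m) (ℚ.p≤q⇒p⊔q≡q v≤m)

  log-high : ∀ {v} → m ℚ.≤ v → log v ≡ L.log m ℚ.+ M.log v
  log-high m≤v = cong₂ (λ x y → L.log x ℚ.+ M.log y) (ℚ.p≥q⇒p⊓q≡q m≤v) (ℚ.p≥q⇒p⊔q≡p m≤v)

  cross : ∀ a b → (L.log m ℚ.- L.log b) ℚ.+ (M.log a ℚ.- M.log m)
                ≡ (L.log m ℚ.+ M.log a) ℚ.- (L.log b ℚ.+ M.log m)
  cross a b = solve 4 (λ x y z t → (x :- y) :+ (z :- t) := (x :+ z) :- (y :+ t)) refl
    (L.log m) (L.log b) (M.log a) (M.log m)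

  total-split : (L.log m ℚ.- L.log l) ℚ.+ (M.log u ℚ.- M.log m) ≡ log u ℚ.- log l
  total-split = trans (cross u l) (cong₂ ℚ._-_ (sym (log-high m≤u)) (sym (log-low l≤m)))

  slope : ∀ {a b} → l ℚ.≤ b → b ℚ.≤ a → a ℚ.≤ u → a ℚ.- b ℚ.≤ a ℚ.* (log a ℚ.- log b)
  slope {a} {b} l≤b b≤a a≤u with ℚ.≤-total a m | ℚ.≤-total b m
  ... | inj₁ a≤m | _ = subst (λ x → a ℚ.- b ℚ.≤ a ℚ.* x)
    (trans (solve 3 (λ x y z → x :- y := (x :+ z) :- (y :+ z)) refl
             (L.log a) (L.log b) (M.log m))
           (cong₂ ℚ._-_ (sym (log-low a≤m)) (sym (log-low (ℚ.≤-trans b≤a a≤m)))))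
    (L.slope l≤b b≤a a≤m)
  ... | inj₂ m≤a | inj₂ m≤b = subst (λ x → a ℚ.- b ℚ.≤ a ℚ.* x)
    (trans (solve 3 (λ x y z → x :- y := (z :+ x) :- (z :+ y)) refl
             (M.log a) (M.log b) (L.log m))
           (cong₂ ℚ._-_ (sym (log-high m≤a)) (sym (log-high m≤b))))
    (M.slope m≤b b≤a a≤u)
  -- Across the cut, `a - b` is split at `m`. The lower part is bounded with factor `m`, which may
  -- be raised to `a` because the increment of `L.log` is nonnegative.
  ... | inj₂ m≤a | inj₁ b≤m = subst₂ ℚ._≤_
    (solve 3 (λ a b m → (m :- b) :+ (a :- m) := a :- b) refl a b m)
    (trans (sym (ℚ.*-distribˡ-+ a _ _))
      (cong (a ℚ.*_) (trans (cross a b)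
        (cong₂ ℚ._-_ (sym (log-high m≤a)) (sym (log-low b≤m))))))
    (ℚ.+-mono-≤
      (ℚ.≤-trans (L.slope l≤b b≤m ℚ.≤-refl)
        (*-monoʳ (≤⇒0≤- (L.log-mono 0<l l≤b b≤m ℚ.≤-refl)) m≤a))
      (M.slope ℚ.≤-refl m≤a a≤u))

-- The slope inequality is homogeneous, so `log (v / s)` inherits it, just as ln (u / l) depends
-- only on the ratio.
scale : ∀ {l u c s} → 0ℚ ℚ.< s → LogBound l u c → LogBound (l ℚ.* s) (u ℚ.* s) c
scale {l} {u} {c} {s} 0<s L = record
  { log   = λ v → log (v ℚ.* inv s)
  ; slope = λ {a} {b} ls≤b b≤a a≤us → subst₂ ℚ._≤_
      (trans (solve 4 (λ a b v s → (a :* v :- b :* v) :* s := a :* v :* s :- b :* v :* s) refl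
               a b (inv s) s)
        (cong₂ ℚ._-_ (*-inv-cancelʳ′ a 0<s) (*-inv-cancelʳ′ b 0<s)))
      (trans (solve 4 (λ a v x s → (a :* v :* x) :* s := (a :* v :* s) :* x) refl
               a (inv s) _ s)
        (cong (ℚ._* (log (a ℚ.* inv s) ℚ.- log (b ℚ.* inv s))) (*-inv-cancelʳ′ a 0<s)))
      (*-monoʳ (ℚ.<⇒≤ 0<s) (slope
        (subst (ℚ._≤ b ℚ.* inv s) (*-inv-cancelʳ l 0<s) (*-monoʳ 0≤v ls≤b))
        (*-monoʳ 0≤v b≤a)
        (subst (a ℚ.* inv s ℚ.≤_) (*-inv-cancelʳ u 0<s) (*-monoʳ 0≤v a≤us))))
  ; total = subst₂ (λ x y → log x ℚ.- log y ℚ.≤ c)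
      (sym (*-inv-cancelʳ u 0<s)) (sym (*-inv-cancelʳ l 0<s)) total
  }
  where
  open LogBound L
  0≤v = ℚ.<⇒≤ (inv-pos 0<s)

-- The counterpart of ln (1 / q^k) = k ln (1 / q): the range is cut at the powers of `q`, and each
-- piece is a scaled copy of the one from `q` to 1.
power : ∀ {q c} → 0ℚ ℚ.< q → q ℚ.≤ 1ℚ → LogBound q 1ℚ c →
        ∀ k → LogBound (pow q k) 1ℚ (nat k ℚ.* c)
power {q} {c} 0<q q≤1 L zero = weaken
  (ℚ.≤-reflexive (trans (ℚ.*-zeroˡ (inv 1ℚ)) (sym (ℚ.*-zeroˡ c)))) (linear 0<1)
power {q} {c} 0<q q≤1 L (suc k) = weaken
  (ℚ.≤-reflexive (solve 2 (λ k c → c :+ k :* c := (con 1ℚ :+ k) :* c) refl (nat k) c))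
  (concat (pow-pos 0<q (suc k)) (pow-step 0<q q≤1 k) (pow≤1 0<q q≤1 k)
    (subst (λ u → LogBound (pow q (suc k)) u c) (ℚ.*-identityˡ _) (scale (pow-pos 0<q k) L))
    (power 0<q q≤1 L k))

-- Gluing linear pieces yields a Riemann sum of 1/t that evaluates at the smaller end of each piece,
-- hence an upper sum.
ascending : ∀ N (p : ℕ → ℚ) → 0ℚ ℚ.< p 0 → (∀ i → p i ℚ.≤ p (suc i)) →
  p 0 ℚ.≤ p N × LogBound (p 0) (p N) (∑< N (λ i → (p (suc i) ℚ.- p i) ℚ.* inv (p i)))
ascending zero p 0<p mono = ℚ.≤-refl , weaken
  (ℚ.≤-reflexive (trans (cong (ℚ._* inv (p 0)) (ℚ.+-inverseʳ (p 0))) (ℚ.*-zeroˡ (inv (p 0)))))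
  (linear 0<p)
ascending (suc N) p 0<p mono =
  let p₁≤ , L = ascending N (λ i → p (suc i)) (ℚ.<-≤-trans 0<p (mono 0)) (λ i → mono (suc i))
  in ℚ.≤-trans (mono 0) p₁≤ , concat 0<p (mono 0) p₁≤ (linear 0<p) L

-- As for `ascending`, but the smaller end of a piece is now its later node. Positivity is asked up
-- to `N` only, as equally spaced decreasing nodes may turn negative beyond it.
descending : ∀ N (p : ℕ → ℚ) → (∀ i → i ℕ.≤ N → 0ℚ ℚ.< p i) → (∀ i → p (suc i) ℚ.≤ p i) →
  p N ℚ.≤ p 0 × LogBound (p N) (p 0) (∑< N (λ i → (p i ℚ.- p (suc i)) ℚ.* inv (p (suc i))))
descending zero p pos anti = ℚ.≤-refl , weaken
  (ℚ.≤-reflexive (trans (cong (ℚ._* inv (p 0)) (ℚ.+-inverseʳ (p 0))) (ℚ.*-zeroˡ (inv (p 0)))))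
  (linear (pos 0 ℕ.z≤n))
descending (suc N) p pos anti =
  let ≤p₁ , L = descending N (λ i → p (suc i)) (λ i i≤N → pos (suc i) (ℕ.s≤s i≤N))
                  (λ i → anti (suc i))
  in ℚ.≤-trans ≤p₁ (anti 0) , weaken (ℚ.≤-reflexive (ℚ.+-comm
         (∑< N (λ i → (p (suc i) ℚ.- p (suc (suc i))) ℚ.* inv (p (suc (suc i)))))
         ((p 0 ℚ.- p 1) ℚ.* inv (p 1))))
       (concat (pos (suc N) ℕ.≤-refl) ≤p₁ (anti 0) L (linear (pos 1 (ℕ.s≤s ℕ.z≤n))))

-- Riemann sums as bounds for logarithms

∑<-shift : ∀ N g → ∑< N (λ i → g (suc i)) ≡ ∑< N g ℚ.+ (g N ℚ.- g 0)
∑<-shift zero    g = sym (trans (ℚ.+-identityˡ _) (ℚ.+-inverseʳ (g 0)))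
∑<-shift (suc N) g = trans (cong (g 1 ℚ.+_) (∑<-shift N (λ i → g (suc i))))
  (solve 4 (λ a b s t → b :+ (s :+ (t :- b)) := (a :+ s) :+ (t :- a)) refl
    (g 0) (g 1) (∑< N (λ i → g (suc i))) (g (suc N)))

∑<-neg : ∀ N g → ∑< N (λ i → ℚ.- g i) ≡ ℚ.- ∑< N g
∑<-neg zero    g = refl
∑<-neg (suc N) g = trans (cong (ℚ.- g 0 ℚ.+_) (∑<-neg N (λ i → g (suc i))))
  (sym (ℚ.neg-distrib-+ (g 0) _))

∑<-nonneg : ∀ N {g} → (∀ i → i ℕ.< N → 0ℚ ℚ.≤ g i) → 0ℚ ℚ.≤ ∑< N g
∑<-nonneg zero    0≤g = ℚ.≤-refl
∑<-nonneg (suc N) 0≤g = 0≤+ (0≤g 0 ℕ.z<s) (∑<-nonneg N (λ i i<N → 0≤g (suc i) (ℕ.s<s i<N)))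

-- The division points of the oriented interval from 1 to `q`, cut into `n + 1` equal pieces.
node : ℚ → ℕ → ℕ → ℚ
node q n i = 1ℚ ℚ.+ nat i ℚ.* width q (suc n)

node-first : ∀ q n → node q n 0 ≡ 1ℚ
node-first q n = trans (cong (1ℚ ℚ.+_) (ℚ.*-zeroˡ (width q (suc n)))) (ℚ.+-identityʳ 1ℚ)

node-last : ∀ q n → node q n (suc n) ≡ q
node-last q n = trans (cong (1ℚ ℚ.+_) (nat*width q n))
  (solve 1 (λ q → con 1ℚ :+ (q :- con 1ℚ) := q) refl q)

node-step : ∀ q n i → node q n (suc i) ℚ.- node q n i ≡ width q (suc n)
node-step q n i = solve 2 (λ i h → (con 1ℚ :+ (con 1ℚ :+ i) :* h) :- (con 1ℚ :+ i :* h) := h) refl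
  (nat i) (width q (suc n))

0≤inv-nat : ∀ n → 0ℚ ℚ.≤ inv (nat (suc n))
0≤inv-nat n = ℚ.<⇒≤ (inv-pos (0<nat n))

-width≡ : ∀ q n → ℚ.- width q (suc n) ≡ (1ℚ ℚ.- q) ℚ.* inv (nat (suc n))
-width≡ q n = solve 2 (λ q v → :- ((q :- con 1ℚ) :* v) := (con 1ℚ :- q) :* v) refl q (inv (nat (suc n)))

0≤-width : ∀ {q} n → q ℚ.≤ 1ℚ → 0ℚ ℚ.≤ ℚ.- width q (suc n)
0≤-width {q} n q≤1 = subst (0ℚ ℚ.≤_) (sym (-width≡ q n)) (0≤* (≤⇒0≤- q≤1) (0≤inv-nat n))

riemann≥0 : ∀ {q} n → 1ℚ ℚ.≤ q → 0ℚ ℚ.≤ riemann q (suc n)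
riemann≥0 {q} n 1≤q = ∑<-nonneg (suc n) λ i i<N → 0≤* (0≤* (≤⇒0≤- 1≤q) (0≤inv-nat n))
  (ℚ.<⇒≤ (inv-pos (ℚ.<-≤-trans 0<1 (node-≥ n i ℚ.≤-refl 1≤q (ℕ.<⇒≤ i<N)))))

0≤-riemann : ∀ {q} n → 0ℚ ℚ.< q → q ℚ.≤ 1ℚ → 0ℚ ℚ.≤ ℚ.- riemann q (suc n)
0≤-riemann {q} n 0<q q≤1 = subst (0ℚ ℚ.≤_) (∑<-neg (suc n) (λ i → width q (suc n) ℚ.* inv (node q n i)))
  (∑<-nonneg (suc n) λ i i<N → subst (0ℚ ℚ.≤_) (sym (ℚ.neg-distribˡ-* (width q (suc n)) _))
    (0≤* (0≤-width n q≤1)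
      (ℚ.<⇒≤ (inv-pos (ℚ.<-≤-trans 0<q (node-≥ n i q≤1 ℚ.≤-refl (ℕ.<⇒≤ i<N)))))))

-- To the right of 1 the left Riemann sum is already the upper one, so no error term appears.
riemann-above : ∀ {q} n → 1ℚ ℚ.≤ q → LogBound 1ℚ q (riemann q (suc n))
riemann-above {q} n 1≤q =
  subst₂ (λ l u → LogBound l u (riemann q (suc n))) (node-first q n) (node-last q n)
    (subst (LogBound (node q n 0) (node q n (suc n)))
      (∑<-cong (suc n) (λ i → cong (ℚ._* inv (node q n i)) (node-step q n i)))
      (proj₂ (ascending (suc n) (node q n)
        (subst (0ℚ ℚ.<_) (sym (node-first q n)) 0<1)
        (λ i → 0≤-⇒≤ (subst (0ℚ ℚ.≤_) (sym (node-step q n i))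
          (0≤* (≤⇒0≤- 1≤q) (0≤inv-nat n)))))))

-- Below 1 the left Riemann sum is the lower one; it differs from the upper one by
-- (1 - q) (1/q - 1) / N.
riemann-below : ∀ {q} n → 0ℚ ℚ.< q → q ℚ.≤ 1ℚ →
  LogBound q 1ℚ (inv (nat (suc n)) ℚ.* inv q ℚ.- riemann q (suc n))
riemann-below {q} n 0<q q≤1 =
  subst₂ (λ l u → LogBound l u (v ℚ.* inv q ℚ.- riemann q (suc n)))
    (node-last q n) (node-first q n)
    (weaken bound (proj₂ (descending (suc n) (node q n)
      (λ i i≤N → ℚ.<-≤-trans 0<q (node-≥ n i q≤1 ℚ.≤-refl i≤N))
      (λ i → 0≤-⇒≤ (subst (0ℚ ℚ.≤_) (sym (-step i)) (0≤-width n q≤1))))))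
  where
  h = width q (suc n)
  v = inv (nat (suc n))
  g : ℕ → ℚ
  g i = h ℚ.* inv (node q n i)

  -step : ∀ i → node q n i ℚ.- node q n (suc i) ≡ ℚ.- h
  -step i = trans (solve 2 (λ a b → a :- b := :- (b :- a)) refl (node q n i) (node q n (suc i)))
                  (cong ℚ.-_ (node-step q n i))

  inv1 : inv 1ℚ ≡ 1ℚ
  inv1 = trans (sym (ℚ.*-identityˡ (inv 1ℚ))) (inv-inverse 0<1)

  sum≡ : ∑< (suc n) (λ i → (node q n i ℚ.- node q n (suc i)) ℚ.* inv (node q n (suc i)))
       ≡ (1ℚ ℚ.- q) ℚ.* v ℚ.* (inv q ℚ.- 1ℚ) ℚ.- riemann q (suc n)
  sum≡ = trans (∑<-cong (suc n) (λ i → trans (cong (ℚ._* inv (node q n (suc i))) (-step i))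
                                         (sym (ℚ.neg-distribˡ-* h (inv (node q n (suc i)))))))
    (trans (∑<-neg (suc n) (λ i → g (suc i)))
    (trans (cong ℚ.-_ (∑<-shift (suc n) g))
    (trans (cong (λ x → ℚ.- (riemann q (suc n) ℚ.+ x))
             (cong₂ (λ x y → h ℚ.* x ℚ.- h ℚ.* y) (cong inv (node-last q n))
                    (trans (cong inv (node-first q n)) inv1)))
      (solve 4 (λ q v w r → :- (r :+ ((q :- con 1ℚ) :* v :* w :- (q :- con 1ℚ) :* v :* con 1ℚ))
                         := (con 1ℚ :- q) :* v :* (w :- con 1ℚ) :- r) refl
        q v (inv q) (riemann q (suc n))))))

  -- The error is relaxed to the simpler `v * inv q`; the slack is `v * (q * inv q) + v * (1 - q)`,
  -- a sum of nonnegative terms.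
  bound : ∑< (suc n) (λ i → (node q n i ℚ.- node q n (suc i)) ℚ.* inv (node q n (suc i)))
          ℚ.≤ v ℚ.* inv q ℚ.- riemann q (suc n)
  bound = subst (ℚ._≤ v ℚ.* inv q ℚ.- riemann q (suc n)) (sym sum≡)
    (ℚ.+-monoˡ-≤ (ℚ.- riemann q (suc n))
      (0≤-⇒≤ {(1ℚ ℚ.- q) ℚ.* v ℚ.* (inv q ℚ.- 1ℚ)} {v ℚ.* inv q} (subst (0ℚ ℚ.≤_)
      (solve 3 (λ q v w → v :* (q :* w) :+ v :* (con 1ℚ :- q) := v :* w :- (con 1ℚ :- q) :* v :* (w :- con 1ℚ)) refl q v (inv q))
      (0≤+ (0≤* (0≤inv-nat n) (0≤* (ℚ.<⇒≤ 0<q) (ℚ.<⇒≤ (inv-pos 0<q))))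
           (0≤* (0≤inv-nat n) (≤⇒0≤- q≤1))))))

-- Meant for `k` = f - 1 and `r` = Δ, the range in which the values of picked vertices lie. The cut
-- at 1 separates the contributions of ln λ and ln Δ.
log-bound : ∀ {q r} n k → 0ℚ ℚ.< q → q ℚ.≤ 1ℚ → 1ℚ ℚ.≤ r → LogBound (pow q k) r
  (nat k ℚ.* (inv (nat (suc n)) ℚ.* inv q ℚ.- riemann q (suc n)) ℚ.+ riemann r (suc n))
log-bound n k 0<q q≤1 1≤r = concat (pow-pos 0<q k) (pow≤1 0<q q≤1 k) 1≤r
  (power 0<q q≤1 (riemann-below n 0<q q≤1) k) (riemann-above n 1≤r)

-- The greedy algorithm for rational λ

∑ℚ : ∀ {A : Set} → List A → (A → ℚ) → ℚ
∑ℚ []       g = 0ℚ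
∑ℚ (x ∷ xs) g = g x ℚ.+ ∑ℚ xs g

-- Indicators replace filtered lists by sums over fixed lists, whose order of summation can be
-- exchanged.
when : ∀ {P : Set} → Dec P → ℚ → ℚ
when (yes _) r = r
when (no _)  r = 0ℚ

when-≥0 : ∀ {P : Set} (P? : Dec P) {r} → 0ℚ ℚ.≤ r → 0ℚ ℚ.≤ when P? r
when-≥0 (yes _) 0≤r = 0≤r
when-≥0 (no _)  _   = ℚ.≤-refl

when-mono : ∀ {P : Set} (P? : Dec P) {r s} → r ℚ.≤ s → when P? r ℚ.≤ when P? s
when-mono (yes _) r≤s = r≤s
when-mono (no _)  _   = ℚ.≤-refl

when-yes : ∀ {P : Set} (P? : Dec P) r → P → when P? r ≡ r
when-yes (yes _) r p = refl
when-yes (no ¬p) r p = ⊥-elim (¬p p)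

*-when : ∀ {P : Set} (P? : Dec P) r s → r ℚ.* when P? s ≡ when P? (r ℚ.* s)
*-when (yes _) r s = refl
*-when (no _)  r s = ℚ.*-zeroʳ r

module _ {A : Set} where

  ∑ℚ-cong : ∀ (xs : List A) {g h : A → ℚ} → (∀ x → g x ≡ h x) → ∑ℚ xs g ≡ ∑ℚ xs h
  ∑ℚ-cong []       g≡h = refl
  ∑ℚ-cong (x ∷ xs) g≡h = cong₂ ℚ._+_ (g≡h x) (∑ℚ-cong xs g≡h)

  ∑ℚ-mono : ∀ (xs : List A) {g h : A → ℚ} → (∀ {x} → x ∈ xs → g x ℚ.≤ h x) → ∑ℚ xs g ℚ.≤ ∑ℚ xs h
  ∑ℚ-mono []       g≤h = ℚ.≤-refl
  ∑ℚ-mono (x ∷ xs) g≤h = ℚ.+-mono-≤ (g≤h (here refl)) (∑ℚ-mono xs (λ x∈ → g≤h (there x∈)))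

  ∑ℚ-≥0 : ∀ (xs : List A) {g : A → ℚ} → (∀ x → 0ℚ ℚ.≤ g x) → 0ℚ ℚ.≤ ∑ℚ xs g
  ∑ℚ-≥0 []       0≤g = ℚ.≤-refl
  ∑ℚ-≥0 (x ∷ xs) 0≤g = 0≤+ (0≤g x) (∑ℚ-≥0 xs 0≤g)

  term≤∑ℚ : ∀ {xs : List A} {g : A → ℚ} {x} → (∀ x → 0ℚ ℚ.≤ g x) → x ∈ xs → g x ℚ.≤ ∑ℚ xs g
  term≤∑ℚ {_ ∷ xs} {g} {x} 0≤g (here refl) = subst (ℚ._≤ g x ℚ.+ ∑ℚ xs g) (ℚ.+-identityʳ (g x))
    (ℚ.+-monoʳ-≤ (g x) (∑ℚ-≥0 xs 0≤g))
  term≤∑ℚ {y ∷ xs} {g} {x} 0≤g (there x∈)  = ℚ.≤-trans (term≤∑ℚ 0≤g x∈)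
    (subst (ℚ._≤ g y ℚ.+ ∑ℚ xs g) (ℚ.+-identityˡ (∑ℚ xs g)) (ℚ.+-monoˡ-≤ (∑ℚ xs g) (0≤g y)))

  ∑ℚ-+ : ∀ (xs : List A) (g h : A → ℚ) → ∑ℚ xs (λ x → g x ℚ.+ h x) ≡ ∑ℚ xs g ℚ.+ ∑ℚ xs h
  ∑ℚ-+ []       g h = refl
  ∑ℚ-+ (x ∷ xs) g h = trans (cong (g x ℚ.+ h x ℚ.+_) (∑ℚ-+ xs g h))
    (solve 4 (λ a b s t → a :+ b :+ (s :+ t) := (a :+ s) :+ (b :+ t)) refl
      (g x) (h x) (∑ℚ xs g) (∑ℚ xs h))

  ∑ℚ-*ˡ : ∀ r (xs : List A) (g : A → ℚ) → ∑ℚ xs (λ x → r ℚ.* g x) ≡ r ℚ.* ∑ℚ xs g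
  ∑ℚ-*ˡ r []       g = sym (ℚ.*-zeroʳ r)
  ∑ℚ-*ˡ r (x ∷ xs) g = trans (cong (r ℚ.* g x ℚ.+_) (∑ℚ-*ˡ r xs g))
                             (sym (ℚ.*-distribˡ-+ r (g x) (∑ℚ xs g)))

  ∑ℚ-const : ∀ (xs : List A) r → ∑ℚ xs (λ _ → r) ≡ nat (length xs) ℚ.* r
  ∑ℚ-const []       r = sym (ℚ.*-zeroˡ r)
  ∑ℚ-const (x ∷ xs) r = trans (cong (r ℚ.+_) (∑ℚ-const xs r))
    (solve 2 (λ n r → r :+ n :* r := (con 1ℚ :+ n) :* r) refl (nat (length xs)) r)

  ∑ℚ-filter : ∀ {P : A → Set} (P? : Decidable P) xs (g : A → ℚ) →
              ∑ℚ (filter P? xs) g ≡ ∑ℚ xs (λ x → when (P? x) (g x))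
  ∑ℚ-filter P? []       g = refl
  ∑ℚ-filter P? (x ∷ xs) g with P? x
  ... | yes _ = cong (g x ℚ.+_) (∑ℚ-filter P? xs g)
  ... | no  _ = trans (∑ℚ-filter P? xs g) (sym (ℚ.+-identityˡ _))

∑ℚ-swap : ∀ {A B : Set} (xs : List A) (ys : List B) (g : A → B → ℚ) →
          ∑ℚ xs (λ x → ∑ℚ ys (g x)) ≡ ∑ℚ ys (λ y → ∑ℚ xs (λ x → g x y))
∑ℚ-swap []       ys g = sym (trans (∑ℚ-const ys 0ℚ) (ℚ.*-zeroʳ (nat (length ys))))
∑ℚ-swap (x ∷ xs) ys g = trans (cong (∑ℚ ys (g x) ℚ.+_) (∑ℚ-swap xs ys g))
                              (sym (∑ℚ-+ ys (g x) (λ y → ∑ℚ xs (λ x → g x y))))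

-- The geometric sum 1 + q + ... + q^(m-1) in Horner form, which avoids dividing by 1 - q.
geo : ℚ → ℕ → ℚ
geo q zero    = 0ℚ
geo q (suc m) = 1ℚ ℚ.+ q ℚ.* geo q m

geo-≥0 : ∀ {q} → 0ℚ ℚ.< q → ∀ m → 0ℚ ℚ.≤ geo q m
geo-≥0 0<q zero    = ℚ.≤-refl
geo-≥0 0<q (suc m) = 0≤+ 0≤1 (0≤* (ℚ.<⇒≤ 0<q) (geo-≥0 0<q m))

geo-mono : ∀ {q} → 0ℚ ℚ.< q → ∀ {m n} → m ℕ.≤ n → geo q m ℚ.≤ geo q n
geo-mono 0<q {n = n} ℕ.z≤n = geo-≥0 0<q n
geo-mono 0<q (ℕ.s≤s m≤n)   = ℚ.+-monoʳ-≤ 1ℚ (*-monoˡ (ℚ.<⇒≤ 0<q) (geo-mono 0<q m≤n))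

geo-telescope : ∀ q m → (1ℚ ℚ.- q) ℚ.* geo q m ≡ 1ℚ ℚ.- pow q m
geo-telescope q zero    = ℚ.*-zeroʳ (1ℚ ℚ.- q)
geo-telescope q (suc m) = trans
  (solve 2 (λ q g → (con 1ℚ :- q) :* (con 1ℚ :+ q :* g) := (con 1ℚ :- q) :+ q :* ((con 1ℚ :- q) :* g))
    refl q (geo q m))
  (trans (cong (λ x → (1ℚ ℚ.- q) ℚ.+ q ℚ.* x) (geo-telescope q m))
    (solve 2 (λ q p → (con 1ℚ :- q) :+ q :* (con 1ℚ :- p) := con 1ℚ :- q :* p) refl q (pow q m)))

-- One step of the summation by parts of T = Σ (Φᵢ₋₁ - Φᵢ) / vᵢ.
abel-step : ∀ {K Φ u v d} → 0ℚ ℚ.≤ K → 0ℚ ℚ.< v → v ℚ.≤ u → Φ ℚ.≤ K ℚ.* v →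
            u ℚ.- v ℚ.≤ u ℚ.* d → Φ ℚ.* (inv v ℚ.- inv u) ℚ.≤ K ℚ.* d
abel-step {K} {Φ} {u} {v} {d} 0≤K 0<v v≤u Φ≤Kv slope = ℚ.≤-trans
  -- As 1/v - 1/u = (u - v)/(uv), replacing `Φ` by `K * v` leaves K (u - v)/u; dividing the slope
  -- hypothesis by `u` finishes.
  (subst₂ ℚ._≤_ (cong (Φ ℚ.*_) (sym (inv-diff 0<v 0<u)))
    (trans (solve 5 (λ K v w x y → K :* v :* (x :* (w :* y)) := K :* (x :* y) :* (v :* w)) refl
             K v (inv v) (u ℚ.- v) (inv u))
           (sym (*-inv-cancel (K ℚ.* ((u ℚ.- v) ℚ.* inv u)) 0<v)))
    (*-monoʳ (0≤* (≤⇒0≤- v≤u) (0≤* (ℚ.<⇒≤ (inv-pos 0<v)) 0≤u⁻¹)) Φ≤Kv))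
  (*-monoˡ 0≤K (subst ((u ℚ.- v) ℚ.* inv u ℚ.≤_)
    (trans (cong (ℚ._* inv u) (ℚ.*-comm u d)) (*-inv-cancelʳ d 0<u))
    (*-monoʳ 0≤u⁻¹ slope)))
  where
  0<u  = ℚ.<-≤-trans 0<v v≤u
  0≤u⁻¹ = ℚ.<⇒≤ (inv-pos 0<u)

module _ {n : ℕ} (H : Hypergraph n) where

  open Hypergraph H

  hits-∈ : ∀ {x F} A → x ∈ˢ F → hits H (x ∷ A) F ≡ suc (hits H A F)
  hits-∈ {F = F} A x∈F = cong length (filter-accept (_∈ˢ? F) {xs = A} x∈F)

  hits-∉ : ∀ {x F} A → ¬ x ∈ˢ F → hits H (x ∷ A) F ≡ hits H A F
  hits-∉ {F = F} A x∉F = cong length (filter-reject (_∈ˢ? F) {xs = A} x∉F)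

  degree≤Δ : ∀ x → degree H x ℕ.≤ Δ H
  degree≤Δ x = All.lookup (xs≤max 0 (map (degree H) (allFin n))) (∈-map⁺ (degree H) (∈-allFin x))

  transversal? : ∀ f A → Dec (IsTransversal H f A)
  transversal? f A with All.all? (λ F → f ℕ.≤? hits H A F) edges
  ... | yes all = yes (All.lookup all)
  ... | no ¬all = no λ t → ¬all (All.tabulate t)

  unsatisfied : ∀ {f A} → ¬ IsTransversal H f A → ∃[ F ] F ∈ edges × hits H A F ℕ.< f
  unsatisfied {f} {A} ¬t with find (¬All⇒Any¬ (λ F → f ℕ.≤? hits H A F) edges (λ all → ¬t (All.lookup all)))
  ... | F , F∈ , ≰ = F , F∈ , ℕ.≰⇒> ≰

  -- Weights may exceed 1 here, so that a transversal raised by a positive constant still qualifies.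
  IsRationalFractionalTransversal : (Fin n → ℚ) → Set
  IsRationalFractionalTransversal w =
    (∀ x → 0ℚ ℚ.≤ w x) ×
    (∀ {F} → F ∈ edges → 1ℚ ℚ.≤ ∑ℚ (filter (_∈ˢ? F) (allFin n)) w)

  module RationalGreedy (f : ℕ) (q : ℚ) where

    weight : ℕ → ℚ
    weight k = when (k ℕ.<? f) (pow q k)

    val : List (Fin n) → Fin n → ℚ
    val A x = ∑ℚ edges (λ F → when (x ∈ˢ? F) (weight (hits H A F)))

    -- Truncated subtraction makes this 0 once `k` reaches `f`.
    rest : ℕ → ℚ
    rest k = pow q k ℚ.* geo q (f ℕ.∸ k)

    -- The total value still to be collected: an edge F contributes
    -- λ^k(F) + … + λ^(f-1).
    potential : List (Fin n) → ℚ
    potential A = ∑ℚ edges (λ F → rest (hits H A F))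

    IsLargest : List (Fin n) → Fin n → Set
    IsLargest A x = ∀ y → val A y ℚ.≤ val A x

    -- Partial executions, with the latest pick at the head of the list; `val A x` is the value of
    -- `x` at the moment it is picked.
    data Run : List (Fin n) → Set where
      []   : Run []
      pick : ∀ {x A} → Run A → ¬ IsTransversal H f A → IsLargest A x → Run (x ∷ A)

    rest-≥f : ∀ {k} → f ℕ.≤ k → rest k ≡ 0ℚ
    rest-≥f {k} f≤k = trans (cong (λ m → pow q k ℚ.* geo q m) (ℕ.m≤n⇒m∸n≡0 f≤k)) (ℚ.*-zeroʳ (pow q k))

    rest-step : ∀ k → rest k ≡ weight k ℚ.+ rest (suc k)
    rest-step k with k ℕ.<? f
    ... | yes k<f = trans (cong (λ m → pow q k ℚ.* geo q m) (ℕ.+-∸-assoc 1 k<f))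
      (solve 3 (λ p q g → p :* (con 1ℚ :+ q :* g) := p :+ q :* p :* g) refl
        (pow q k) q (geo q (f ℕ.∸ suc k)))
    ... | no  k≮f = trans (rest-≥f f≤k)
      (sym (trans (ℚ.+-identityˡ (rest (suc k))) (rest-≥f (ℕ.m≤n⇒m≤1+n f≤k))))
      where f≤k = ℕ.≮⇒≥ k≮f

    -- Each edge through `x` loses the leading term of its remaining sum, which is what it
    -- contributes to the value of `x`; all other edges are unchanged.
    potential-pick : ∀ A x → potential A ≡ val A x ℚ.+ potential (x ∷ A)
    potential-pick A x = trans (∑ℚ-cong edges split) (∑ℚ-+ edges
      (λ F → when (x ∈ˢ? F) (weight (hits H A F))) (λ F → rest (hits H (x ∷ A) F)))
      where
      split : ∀ F → rest (hits H A F) ≡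
                    when (x ∈ˢ? F) (weight (hits H A F)) ℚ.+ rest (hits H (x ∷ A) F)
      split F = go (x ∈ˢ? F)
        where
        go : (d : Dec (x ∈ˢ F)) → rest (hits H A F) ≡
                    when d (weight (hits H A F)) ℚ.+ rest (hits H (x ∷ A) F)
        go (yes x∈F) = trans (rest-step (hits H A F))
          (cong (λ k → weight (hits H A F) ℚ.+ rest k) (sym (hits-∈ A x∈F)))
        go (no x∉F)  = sym (trans (ℚ.+-identityˡ (rest (hits H (x ∷ A) F)))
                                  (cong rest (hits-∉ A x∉F)))

    module _ (0<q : 0ℚ ℚ.< q) (q≤1 : q ℚ.≤ 1ℚ) where

      weight-≥0 : ∀ k → 0ℚ ℚ.≤ weight k
      weight-≥0 k = when-≥0 (k ℕ.<? f) (ℚ.<⇒≤ (pow-pos 0<q k))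

      weight-≤1 : ∀ k → weight k ℚ.≤ 1ℚ
      weight-≤1 k with k ℕ.<? f
      ... | yes _ = pow≤1 0<q q≤1 k
      ... | no  _ = 0≤1

      weight-step : ∀ k → weight (suc k) ℚ.≤ weight k
      weight-step k with suc k ℕ.<? f
      ... | no  _     = weight-≥0 k
      ... | yes 1+k<f = subst (pow q (suc k) ℚ.≤_) (sym (when-yes (k ℕ.<? f) _ (ℕ.<⇒≤ 1+k<f)))
                          (pow-step 0<q q≤1 k)

      rest-≥0 : ∀ k → 0ℚ ℚ.≤ rest k
      rest-≥0 k = 0≤* (ℚ.<⇒≤ (pow-pos 0<q k)) (geo-≥0 0<q (f ℕ.∸ k))

      -- The remaining terms are at most `f` in number and start with `weight k`; this is where the
      -- constant C enters. From `f` on both sides vanish.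
      rest≤ : ∀ k → rest k ℚ.≤ geo q f ℚ.* weight k
      rest≤ k with k ℕ.<? f
      ... | yes _   = subst (rest k ℚ.≤_) (ℚ.*-comm (pow q k) (geo q f))
        (*-monoˡ (ℚ.<⇒≤ (pow-pos 0<q k)) (geo-mono 0<q (ℕ.m∸n≤m f k)))
      ... | no  k≮f = ℚ.≤-reflexive (trans (rest-≥f (ℕ.≮⇒≥ k≮f)) (sym (ℚ.*-zeroʳ (geo q f))))

      potential-≥0 : ∀ A → 0ℚ ℚ.≤ potential A
      potential-≥0 A = ∑ℚ-≥0 edges (λ F → rest-≥0 (hits H A F))

      -- A pick can only raise hit counts, and weights decrease with the count. Hence the values of
      -- successive greedy picks never increase.
      val-antitone : ∀ A x y → val (x ∷ A) y ℚ.≤ val A y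
      val-antitone A x y = ∑ℚ-mono edges λ {F} _ → when-mono (y ∈ˢ? F) (step F)
        where
        step : ∀ F → weight (hits H (x ∷ A) F) ℚ.≤ weight (hits H A F)
        step F with x ∈ˢ? F
        ... | yes _ = weight-step (hits H A F)
        ... | no  _ = ℚ.≤-refl

      val≤Δ : ∀ A x → val A x ℚ.≤ nat (Δ H)
      val≤Δ A x = ℚ.≤-trans
        (subst (val A x ℚ.≤_)
          (trans (sym (∑ℚ-filter (x ∈ˢ?_) edges (λ _ → 1ℚ)))
            (trans (∑ℚ-const (filter (x ∈ˢ?_) edges) 1ℚ) (ℚ.*-identityʳ _)))
          (∑ℚ-mono edges λ {F} _ → when-mono (x ∈ˢ? F) (weight-≤1 (hits H A F))))
        (nat-mono (degree≤Δ x))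

      -- Some edge has been hit at most f - 1 times, so any vertex of it has at least this value,
      -- and the largest value is no smaller.
      largest-lower : ∀ {A x} → ¬ IsTransversal H f A → IsLargest A x → pow q (ℕ.pred f) ℚ.≤ val A x
      largest-lower {A} {x} ¬t largest with unsatisfied {A = A} ¬t
      ... | F , F∈ , k<f with edge-nonempty F∈
      ...   | y , y∈F = begin
        pow q (ℕ.pred f)                        ≤⟨ pow-antitone 0<q q≤1 (ℕ.<⇒≤pred k<f) ⟩
        pow q k                                 ≡⟨ when-yes (k ℕ.<? f) (pow q k) k<f ⟨
        weight k                                ≡⟨ when-yes (y ∈ˢ? F) (weight k) y∈F ⟨
        when (y ∈ˢ? F) (weight k)               ≤⟨ term≤∑ℚ {g = λ F → when (y ∈ˢ? F) (weight (hits H A F))}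
                                                    (λ F → when-≥0 (y ∈ˢ? F) (weight-≥0 (hits H A F))) F∈ ⟩
        val A y                                 ≤⟨ largest y ⟩
        val A x                                 ∎
        where
        open ℚ.≤-Reasoning
        k = hits H A F

      -- Double counting: multiplying the weight of each edge by its cover, which is at least 1, and
      -- exchanging the sums gives a `w`-weighted sum of vertex values, each at most `v`.
      potential≤ : ∀ {w A v} → IsRationalFractionalTransversal w → (∀ y → val A y ℚ.≤ v) →
                   potential A ℚ.≤ geo q f ℚ.* ∑ℚ (allFin n) w ℚ.* v
      potential≤ {w} {A} {v} (0≤w , 1≤w) val≤v = begin
        potential A
          ≤⟨ ∑ℚ-mono edges (λ {F} _ → rest≤ (hits H A F)) ⟩
        ∑ℚ edges (λ F → C ℚ.* g F)
          ≡⟨ ∑ℚ-*ˡ C edges g ⟩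
        C ℚ.* ∑ℚ edges g
          ≤⟨ *-monoˡ (geo-≥0 0<q f) (∑ℚ-mono edges (λ {F} F∈ → subst (ℚ._≤ g F ℚ.* cover F)
               (ℚ.*-identityʳ (g F)) (*-monoˡ (weight-≥0 (hits H A F)) (1≤w F∈)))) ⟩
        C ℚ.* ∑ℚ edges (λ F → g F ℚ.* cover F)
          ≡⟨ cong (C ℚ.*_) double-count ⟩
        C ℚ.* ∑ℚ (allFin n) (λ x → w x ℚ.* val A x)
          ≤⟨ *-monoˡ (geo-≥0 0<q f) (∑ℚ-mono (allFin n) (λ {x} _ → *-monoˡ (0≤w x) (val≤v x))) ⟩
        C ℚ.* ∑ℚ (allFin n) (λ x → w x ℚ.* v)
          ≡⟨ cong (C ℚ.*_) (trans (∑ℚ-cong (allFin n) (λ x → ℚ.*-comm (w x) v)) (∑ℚ-*ˡ v (allFin n) w)) ⟩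
        C ℚ.* (v ℚ.* ∑ℚ (allFin n) w)
          ≡⟨ solve 3 (λ C v W → C :* (v :* W) := C :* W :* v) refl C v (∑ℚ (allFin n) w) ⟩
        C ℚ.* ∑ℚ (allFin n) w ℚ.* v ∎
        where
        open ℚ.≤-Reasoning
        C = geo q f
        g : Subset n → ℚ
        g F = weight (hits H A F)
        cover : Subset n → ℚ
        cover F = ∑ℚ (filter (_∈ˢ? F) (allFin n)) w
        double-count : ∑ℚ edges (λ F → g F ℚ.* cover F) ≡ ∑ℚ (allFin n) (λ x → w x ℚ.* val A x)
        double-count = trans
          (∑ℚ-cong edges λ F → trans (cong (g F ℚ.*_) (∑ℚ-filter (_∈ˢ? F) (allFin n) w))
            (trans (sym (∑ℚ-*ˡ (g F) (allFin n) (λ x → when (x ∈ˢ? F) (w x))))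
              (∑ℚ-cong (allFin n) λ x → trans (*-when (x ∈ˢ? F) (g F) (w x))
                (trans (cong (when (x ∈ˢ? F)) (ℚ.*-comm (g F) (w x)))
                  (sym (*-when (x ∈ˢ? F) (w x) (g F)))))))
          (trans (∑ℚ-swap edges (allFin n) (λ F x → w x ℚ.* when (x ∈ˢ? F) (g F)))
            (∑ℚ-cong (allFin n) λ x → ∑ℚ-*ˡ (w x) edges (λ F → when (x ∈ˢ? F) (g F))))

      module _ {w : Fin n → ℚ} {c : ℚ} (frac : IsRationalFractionalTransversal w)
               (L : LogBound (pow q (ℕ.pred f)) (nat (Δ H)) c) where

        open LogBound L

        private
          K : ℚ
          K = geo q f ℚ.* ∑ℚ (allFin n) w

          0≤K : 0ℚ ℚ.≤ K
          0≤K = 0≤* (geo-≥0 0<q f) (∑ℚ-≥0 (allFin n) (proj₁ frac))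

          0<μ : 0ℚ ℚ.< pow q (ℕ.pred f)
          0<μ = pow-pos 0<q (ℕ.pred f)

        -- Summation by parts as an induction over the run. Initially Φ / v is at most `K` and v at
        -- most Δ; afterwards each growth of Φ / v caused by a falling value is paid for by the fall
        -- of `K * log v`.
        run-invariant : ∀ {x A} → Run (x ∷ A) →
          nat (length A) ℚ.+ potential A ℚ.* inv (val A x) ℚ.+ K ℚ.* log (val A x)
            ℚ.≤ K ℚ.+ K ℚ.* log (nat (Δ H))
        run-invariant {x} {[]} (pick [] ¬t largest) = ℚ.+-mono-≤
          (subst₂ ℚ._≤_ (sym (ℚ.+-identityˡ _)) (*-inv-cancelʳ K 0<v)
            (*-monoʳ (ℚ.<⇒≤ (inv-pos 0<v)) (potential≤ {w} {[]} frac largest)))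
          (*-monoˡ 0≤K (log-mono 0<μ μ≤v (val≤Δ [] x) ℚ.≤-refl))
          where
          μ≤v = largest-lower {[]} {x} ¬t largest
          0<v = ℚ.<-≤-trans 0<μ μ≤v
        run-invariant {x} {A@(y ∷ B)} (pick run@(pick _ ¬tB largestB) ¬t largest) = begin
          (1ℚ ℚ.+ nat (length B)) ℚ.+ Φ ℚ.* inv v ℚ.+ K ℚ.* log v
            -- Writing 1/v as 1/u + (1/v - 1/u) isolates the change of value; the 1 counting the
            -- pick of `y` joins `Φ * inv u` to form `potential B * inv u`.
            ≡⟨ solve 5 (λ n Φ v⁻¹ u⁻¹ kv → (con 1ℚ :+ n) :+ Φ :* v⁻¹ :+ kv
                      := (n :+ (con 1ℚ :+ Φ :* u⁻¹) :+ kv) :+ Φ :* (v⁻¹ :- u⁻¹))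
                 refl (nat (length B)) Φ (inv v) (inv u) (K ℚ.* log v) ⟩
          nat (length B) ℚ.+ (1ℚ ℚ.+ Φ ℚ.* inv u) ℚ.+ K ℚ.* log v ℚ.+ Φ ℚ.* (inv v ℚ.- inv u)
            ≤⟨ ℚ.+-monoʳ-≤ (nat (length B) ℚ.+ (1ℚ ℚ.+ Φ ℚ.* inv u) ℚ.+ K ℚ.* log v)
                 (abel-step {K} {Φ} 0≤K 0<v v≤u (potential≤ {w} {A} frac largest)
                   (slope μ≤v v≤u (val≤Δ B y))) ⟩
          nat (length B) ℚ.+ (1ℚ ℚ.+ Φ ℚ.* inv u) ℚ.+ K ℚ.* log v ℚ.+ K ℚ.* (log u ℚ.- log v)
            ≡⟨ solve 5 (λ n z K lu lv → n :+ z :+ K :* lv :+ K :* (lu :- lv) := n :+ z :+ K :* lu)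
                 refl (nat (length B)) (1ℚ ℚ.+ Φ ℚ.* inv u) K (log u) (log v) ⟩
          nat (length B) ℚ.+ (1ℚ ℚ.+ Φ ℚ.* inv u) ℚ.+ K ℚ.* log u
            ≡⟨ cong (λ z → nat (length B) ℚ.+ z ℚ.+ K ℚ.* log u) (sym collect) ⟩
          nat (length B) ℚ.+ potential B ℚ.* inv u ℚ.+ K ℚ.* log u
            ≤⟨ run-invariant run ⟩
          K ℚ.+ K ℚ.* log (nat (Δ H)) ∎
          where
          open ℚ.≤-Reasoning
          Φ = potential A
          u = val B y
          v = val A x
          μ≤v = largest-lower {A} {x} ¬t largest
          0<v = ℚ.<-≤-trans 0<μ μ≤v
          v≤u : v ℚ.≤ u
          v≤u = ℚ.≤-trans (val-antitone B y x) (largestB x)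
          0<u = ℚ.<-≤-trans 0<v v≤u
          collect : potential B ℚ.* inv u ≡ 1ℚ ℚ.+ Φ ℚ.* inv u
          collect = trans (cong (ℚ._* inv u) (potential-pick B y))
            (trans (ℚ.*-distribʳ-+ (inv u) u Φ) (cong (ℚ._+ Φ ℚ.* inv u) (inv-inverse 0<u)))

        -- The invariant counts the picks before the last one; the last is covered by Φ / v, and
        -- `log v` is bounded below by its value at λ^(f-1).
        run-length : ∀ {A} → Run A → nat (length A) ℚ.≤ K ℚ.* (1ℚ ℚ.+ c)
        -- The empty run requires `c` to be nonnegative: it bounds the rise of a monotone `log`.
        run-length [] = 0≤* 0≤K (0≤+ 0≤1 (ℚ.≤-trans
          (≤⇒0≤- (log-mono 0<μ ℚ.≤-refl μ≤Δ ℚ.≤-refl)) total))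
          where
          μ≤Δ : pow q (ℕ.pred f) ℚ.≤ nat (Δ H)
          μ≤Δ = ℚ.≤-trans (pow≤1 0<q q≤1 (ℕ.pred f)) (nat-mono (1≤Δ H))
        run-length {x ∷ A} run@(pick _ ¬t largest) = begin
          1ℚ ℚ.+ nat (length A)
            ≡⟨ solve 3 (λ n k l → con 1ℚ :+ n := (n :+ con 1ℚ :+ k :* l) :- k :* l)
                 refl (nat (length A)) K (log v) ⟩
          (nat (length A) ℚ.+ 1ℚ ℚ.+ K ℚ.* log v) ℚ.- K ℚ.* log v
            ≤⟨ ℚ.+-mono-≤
                 (ℚ.≤-trans (ℚ.+-monoˡ-≤ (K ℚ.* log v) (ℚ.+-monoʳ-≤ (nat (length A)) 1≤Φ/v))
                            (run-invariant run))
                 (ℚ.neg-antimono-≤ (*-monoˡ 0≤K (log-mono 0<μ ℚ.≤-refl μ≤v (val≤Δ A x)))) ⟩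
          (K ℚ.+ K ℚ.* log (nat (Δ H))) ℚ.- K ℚ.* log μ
            ≡⟨ solve 3 (λ k a b → (k :+ k :* a) :- k :* b := k :* (con 1ℚ :+ (a :- b)))
                 refl K (log (nat (Δ H))) (log μ) ⟩
          K ℚ.* (1ℚ ℚ.+ (log (nat (Δ H)) ℚ.- log μ))
            ≤⟨ *-monoˡ 0≤K (ℚ.+-monoʳ-≤ 1ℚ total) ⟩
          K ℚ.* (1ℚ ℚ.+ c) ∎
          where
          open ℚ.≤-Reasoning
          μ = pow q (ℕ.pred f)
          v = val A x
          μ≤v = largest-lower {A} {x} ¬t largest
          0<v = ℚ.<-≤-trans 0<μ μ≤v
          -- The potential before the last pick still contains the value `v` collected by that pick.
          1≤Φ/v : 1ℚ ℚ.≤ potential A ℚ.* inv v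
          1≤Φ/v = subst₂ ℚ._≤_ (inv-inverse 0<v) (cong (ℚ._* inv v) (sym (potential-pick A x)))
            (*-monoʳ (ℚ.<⇒≤ (inv-pos 0<v)) (subst (ℚ._≤ v ℚ.+ potential (x ∷ A)) (ℚ.+-identityʳ v)
              (ℚ.+-monoʳ-≤ v (potential-≥0 (x ∷ A)))))

-- Approximation of reals

Eventually : (ℕ → Set) → Set
Eventually P = ∃[ N ] ∀ n → N ℕ.≤ n → P n

always : ∀ {P : ℕ → Set} → (∀ n → P n) → Eventually P
always p = 0 , λ n _ → p n

eventually-map : ∀ {P Q : ℕ → Set} → (∀ n → P n → Q n) → Eventually P → Eventually Q
eventually-map h (N , p) = N , λ n N≤n → h n (p n N≤n)

eventually-zip : ∀ {P Q R : ℕ → Set} → (∀ n → P n → Q n → R n) →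
                 Eventually P → Eventually Q → Eventually R
eventually-zip h (M , p) (N , q) = M ℕ.⊔ N , λ n ≤n →
  h n (p n (ℕ.m⊔n≤o⇒m≤o M N ≤n)) (q n (ℕ.m⊔n≤o⇒n≤o M N ≤n))

eventually-all : ∀ {A : Set} {P : A → ℕ → Set} (xs : List A) →
  (∀ {x} → x ∈ xs → Eventually (P x)) → Eventually (λ n → ∀ {x} → x ∈ xs → P x n)
eventually-all {P = P} []       p = always λ n ()
eventually-all {P = P} (x ∷ xs) p = eventually-zip {P = P x} {Q = λ n → ∀ {y} → y ∈ xs → P y n}
  (λ { n px pxs (here refl) → px ; n px pxs (there y∈) → pxs y∈ })
  (p (here refl)) (eventually-all {P = P} xs (λ x∈ → p (there x∈)))

p≤∣p∣ : ∀ p → p ℚ.≤ ∣ p ∣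
p≤∣p∣ p with ℚ.≤-total 0ℚ p
... | inj₁ 0≤p = ℚ.≤-reflexive (sym (ℚ.0≤p⇒∣p∣≡p 0≤p))
... | inj₂ p≤0 = ℚ.≤-trans p≤0 (ℚ.0≤∣p∣ p)

halves : ∀ ε → ½ ℚ.* ε ℚ.+ ½ ℚ.* ε ≡ ε
halves ε = trans (sym (ℚ.*-distribʳ-+ ε ½ ½)) (ℚ.*-identityˡ ε)

0<half : ∀ {ε} → 0ℚ ℚ.< ε → 0ℚ ℚ.< ½ ℚ.* ε
0<half = 0<* (ℚ.positive⁻¹ ½)

0<⊓ : ∀ {p q} → 0ℚ ℚ.< p → 0ℚ ℚ.< q → 0ℚ ℚ.< p ℚ.⊓ q
0<⊓ {p} {q} 0<p 0<q with ℚ.≤-total p q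
... | inj₁ p≤q = subst (0ℚ ℚ.<_) (sym (ℚ.p≤q⇒p⊓q≡p p≤q)) 0<p
... | inj₂ q≤p = subst (0ℚ ℚ.<_) (sym (ℚ.p≥q⇒p⊓q≡q q≤p)) 0<q

shrink : ∀ {K} ε → 0ℚ ℚ.≤ K → 0ℚ ℚ.< ε → ∃[ η ] 0ℚ ℚ.< η × η ℚ.≤ 1ℚ × K ℚ.* η ℚ.≤ ε
-- The denominator ε + (1 + K) dominates both `ε` and `K`, so one quotient meets both bounds.
shrink {K} ε 0≤K 0<ε = ε ℚ.* inv D , 0<* 0<ε 0<v , ε/D≤1 , Kε/D≤ε
  where
  D = ε ℚ.+ (1ℚ ℚ.+ K)
  0≤1+K = 0≤+ 0≤1 0≤K
  0<D : 0ℚ ℚ.< D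
  0<D = 0<+ 0<ε 0≤1+K
  0<v = inv-pos 0<D
  ε≤D : ε ℚ.≤ D
  ε≤D = 0≤-⇒≤ (subst (0ℚ ℚ.≤_) (solve 2 (λ e k → k := (e :+ k) :- e) refl ε (1ℚ ℚ.+ K)) 0≤1+K)
  K≤D : K ℚ.≤ D
  K≤D = 0≤-⇒≤ (subst (0ℚ ℚ.≤_)
    (solve 2 (λ e k → e :+ con 1ℚ := (e :+ (con 1ℚ :+ k)) :- k) refl ε K) (0≤+ (ℚ.<⇒≤ 0<ε) 0≤1))
  ε/D≤1 : ε ℚ.* inv D ℚ.≤ 1ℚ
  ε/D≤1 = subst (ε ℚ.* inv D ℚ.≤_) (inv-inverse 0<D) (*-monoʳ (ℚ.<⇒≤ 0<v) ε≤D)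
  Kε/D≤ε : K ℚ.* (ε ℚ.* inv D) ℚ.≤ ε
  Kε/D≤ε = subst₂ ℚ._≤_
    (solve 3 (λ k e v → (e :* v) :* k := k :* (e :* v)) refl K ε (inv D))
    (*-inv-cancelʳ′ ε 0<D)
    (*-monoˡ (ℚ.<⇒≤ (0<* 0<ε 0<v)) K≤D)

infix 4 _≈_
-- Equality of limits in absolute-value form, suited to Lipschitz estimates.
_≈_ : ℝ → ℝ → Set
x ≈ y = ∀ ε → 0ℚ ℚ.< ε → Eventually (λ n → ∣ seq x n ℚ.- seq y n ∣ ℚ.≤ ε)

≃⇒≈ : ∀ {x y} → x ≃ y → x ≈ y
≃⇒≈ {x} {y} (x≤y , y≤x) ε 0<ε = eventually-zip close (x≤y ε 0<ε) (y≤x ε 0<ε)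
  where
  shift : ∀ {a b} → a ℚ.≤ b ℚ.+ ε → a ℚ.- b ℚ.≤ ε
  shift {a} {b} a≤b+ε = subst (a ℚ.- b ℚ.≤_) (solve 2 (λ b e → (b :+ e) :- b := e) refl b ε)
    (ℚ.+-monoˡ-≤ (ℚ.- b) a≤b+ε)
  close : ∀ n → seq x n ℚ.≤ seq y n ℚ.+ ε → seq y n ℚ.≤ seq x n ℚ.+ ε →
          ∣ seq x n ℚ.- seq y n ∣ ℚ.≤ ε
  close n x≤ y≤ with ℚ.∣p∣≡p∨∣p∣≡-p (seq x n ℚ.- seq y n)
  ... | inj₁ eq = subst (ℚ._≤ ε) (sym eq) (shift x≤)
  ... | inj₂ eq = subst (ℚ._≤ ε)
    (trans (solve 2 (λ a b → b :- a := :- (a :- b)) refl (seq x n) (seq y n)) (sym eq)) (shift y≤)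

≈⇒≤ : ∀ {x y} → x ≈ y → x ≤ y
≈⇒≤ {x} {y} x≈y ε 0<ε = eventually-map (λ n close → subst (ℚ._≤ seq y n ℚ.+ ε)
    (solve 2 (λ a b → b :+ (a :- b) := a) refl (seq x n) (seq y n))
    (ℚ.+-monoʳ-≤ (seq y n) (ℚ.≤-trans (p≤∣p∣ (seq x n ℚ.- seq y n)) close)))
  (x≈y ε 0<ε)

≈-sym : ∀ {x y} → x ≈ y → y ≈ x
≈-sym {x} {y} x≈y ε 0<ε = eventually-map
  (λ n → subst (ℚ._≤ ε) (∣a-b∣≡∣b-a∣ (seq x n) (seq y n))) (x≈y ε 0<ε)

seq≡⇒≈ : ∀ {x y} → (∀ n → seq x n ≡ seq y n) → x ≈ y
seq≡⇒≈ {x} {y} eq ε 0<ε = always λ n → subst (ℚ._≤ ε)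
  (sym (cong ∣_∣ (trans (cong (ℚ._- seq y n) (eq n)) (ℚ.+-inverseʳ (seq y n))))) (ℚ.<⇒≤ 0<ε)

≤-trans : ∀ {x y z} → x ≤ y → y ≤ z → x ≤ z
≤-trans {x} {y} {z} x≤y y≤z ε 0<ε = eventually-zip
  (λ n x≤ y≤ → ℚ.≤-trans x≤ (subst (seq y n ℚ.+ ½ ℚ.* ε ℚ.≤_)
    (trans (ℚ.+-assoc (seq z n) (½ ℚ.* ε) (½ ℚ.* ε)) (cong (seq z n ℚ.+_) (halves ε)))
    (ℚ.+-monoˡ-≤ (½ ℚ.* ε) y≤)))
  (x≤y (½ ℚ.* ε) (0<half 0<ε)) (y≤z (½ ℚ.* ε) (0<half 0<ε))

≈-trans : ∀ {x y z} → x ≈ y → y ≈ z → x ≈ z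
≈-trans {x} {y} {z} x≈y y≈z ε 0<ε = eventually-zip
  (λ n xy yz → ℚ.≤-trans (triangle (seq x n) (seq y n) (seq z n))
    (subst (∣ seq x n ℚ.- seq y n ∣ ℚ.+ ∣ seq y n ℚ.- seq z n ∣ ℚ.≤_) (halves ε)
      (ℚ.+-mono-≤ xy yz)))
  (x≈y (½ ℚ.* ε) (0<half 0<ε)) (y≈z (½ ℚ.* ε) (0<half 0<ε))

fromℚ-cancel-≤ : ∀ {p q} → fromℚ p ≤ fromℚ q → p ℚ.≤ q
fromℚ-cancel-≤ {p} {q} p≤q = ℚ.≮⇒≥ λ q<p →
  -- The tolerance `r - q`, for a rational `r` strictly between `q` and `p`, would force `p` below
  -- `r`.
  let r , q<r , r<p = ℚ.<-dense q<p
      N , close = p≤q (r ℚ.- q) (subst (ℚ._< r ℚ.- q) (ℚ.+-inverseʳ q) (ℚ.+-monoˡ-< (ℚ.- q) q<r))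
  in ℚ.<-irrefl refl (ℚ.<-≤-trans r<p (subst (p ℚ.≤_)
       (solve 2 (λ q r → q :+ (r :- q) := r) refl q r) (close N ℕ.≤-refl)))

fromℚ-mono-≤ : ∀ {p q} → p ℚ.≤ q → fromℚ p ≤ fromℚ q
fromℚ-mono-≤ {p} {q} p≤q ε 0<ε = always λ n → ℚ.≤-trans p≤q
  (subst (ℚ._≤ q ℚ.+ ε) (ℚ.+-identityʳ q) (ℚ.+-monoʳ-≤ q (ℚ.<⇒≤ 0<ε)))

≈-rescale : ∀ {x y} K → 0ℚ ℚ.≤ K →
  (∀ ε → 0ℚ ℚ.< ε → Eventually (λ n → ∣ seq x n ℚ.- seq y n ∣ ℚ.≤ K ℚ.* ε)) → x ≈ y
≈-rescale K 0≤K close ε 0<ε =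
  let η , 0<η , _ , Kη≤ε = shrink ε 0≤K 0<ε
  in eventually-map (λ n h → ℚ.≤-trans h Kη≤ε) (close η 0<η)

≈-refl : ∀ {x} → x ≈ x
≈-refl {x} = seq≡⇒≈ {x} {x} (λ n → refl)

≈-neg : ∀ {x y} → x ≈ y → - x ≈ - y
≈-neg {x} {y} x≈y ε 0<ε = eventually-map (λ n → subst (ℚ._≤ ε)
  (trans (∣a-b∣≡∣b-a∣ (seq x n) (seq y n))
    (cong ∣_∣ (solve 2 (λ a b → b :- a := (:- a) :- (:- b)) refl (seq x n) (seq y n)))))
  (x≈y ε 0<ε)

≈-+ : ∀ {x y u v} → x ≈ y → u ≈ v → x + u ≈ y + v
≈-+ {x} {y} {u} {v} x≈y u≈v = ≈-rescale {x + u} {y + v} (1ℚ ℚ.+ 1ℚ) (0≤+ 0≤1 0≤1) λ ε 0<ε →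
  eventually-zip (λ n xy uv → subst₂ ℚ._≤_
    (cong ∣_∣ (solve 4 (λ a b c d → (a :- b) :+ (c :- d) := (a :+ c) :- (b :+ d)) refl
      (seq x n) (seq y n) (seq u n) (seq v n)))
    (solve 1 (λ e → e :+ e := (con 1ℚ :+ con 1ℚ) :* e) refl ε)
    (ℚ.≤-trans (ℚ.∣p+q∣≤∣p∣+∣q∣ (seq x n ℚ.- seq y n) (seq u n ℚ.- seq v n)) (ℚ.+-mono-≤ xy uv)))
  (x≈y ε 0<ε) (u≈v ε 0<ε)

≈-* : ∀ {x y u v} → x ≈ y → u ≈ v → x * u ≈ y * v
≈-* {x} {y} {u} {v} x≈y u≈v =
  let B , 0≤B , u≤B = bounded (seq u) (cauchy u)
      A , 0≤A , y≤A = bounded (seq y) (cauchy y)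
  in ≈-rescale {x * u} {y * v} (B ℚ.+ A) (0≤+ {B} {A} 0≤B 0≤A) λ ε 0<ε →
  eventually-zip {P = λ n → ∣ seq u n ∣ ℚ.≤ B × ∣ seq y n ∣ ℚ.≤ A}
    (λ n (u≤ , y≤) (xy , uv) →
      product-close (seq x n) (seq u n) (seq y n) (seq v n) {A} {B} {ε} 0≤A 0≤B u≤ y≤ xy uv)
    (eventually-zip (λ n → _,_) u≤B y≤A)
    (eventually-zip (λ n → _,_) (x≈y ε 0<ε) (u≈v ε 0<ε))

≈-^ : ∀ {x y} → x ≈ y → ∀ k → x ^ k ≈ y ^ k
≈-^ {x} {y} x≈y zero    = ≈-refl {1ℝ}
≈-^ {x} {y} x≈y (suc k) = ≈-* {x} {y} {x ^ k} {y ^ k} x≈y (≈-^ {x} {y} x≈y k)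

module _ {x y} (0<x : 0ℝ < x) (0<y : 0ℝ < y) where

  private
    η = proj₁ 0<x ℚ.⊓ proj₁ 0<y
    -- A common lower bound of both sequences, capped at 1 because the Riemann sums start at 1.
    δ = η ℚ.⊓ 1ℚ
    0<η : 0ℚ ℚ.< η
    0<η = 0<⊓ (proj₁ (proj₂ 0<x)) (proj₁ (proj₂ 0<y))
    0<δ : 0ℚ ℚ.< δ
    0<δ = 0<⊓ 0<η 0<1
    D = inv δ ℚ.* inv δ
    0≤D : 0ℚ ℚ.≤ D
    0≤D = 0≤* (ℚ.<⇒≤ (inv-pos 0<δ)) (ℚ.<⇒≤ (inv-pos 0<δ))
    above : Eventually (λ n → δ ℚ.≤ seq x n × δ ℚ.≤ seq y n)
    above = eventually-zip
      (λ n x≥ y≥ → ℚ.≤-trans (ℚ.p⊓q≤p η 1ℚ) (ℚ.≤-trans (ℚ.p⊓q≤p (proj₁ 0<x) (proj₁ 0<y)) x≥)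
                 , ℚ.≤-trans (ℚ.p⊓q≤p η 1ℚ) (ℚ.≤-trans (ℚ.p⊓q≤q (proj₁ 0<x) (proj₁ 0<y)) y≥))
      (positive⇒above {x} 0<x) (positive⇒above {y} 0<y)

  ≈-÷ : ∀ {u v} → u ≈ v → x ≈ y → u ÷ x [ 0<x ] ≈ v ÷ y [ 0<y ]
  ≈-÷ {u} {v} u≈v x≈y = ≈-* {u} {v} {x⁻¹} {y⁻¹} u≈v (≈-rescale {x⁻¹} {y⁻¹} D 0≤D λ ε 0<ε →
    eventually-zip (λ n (x≥ , y≥) close → ℚ.≤-trans (inv-dist 0<δ x≥ y≥)
      (subst (ℚ._≤ D ℚ.* ε) (ℚ.*-comm D ∣ seq x n ℚ.- seq y n ∣) (*-monoˡ 0≤D close)))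
    above (x≈y ε 0<ε))
    where
    x⁻¹ = mkℝ (λ n → inv (seq x n))
      (CauchyFacts.inv-cauchy (seq x) (cauchy x) (proj₁ (proj₂ 0<x)) (positive⇒above {x} 0<x))
    y⁻¹ = mkℝ (λ n → inv (seq y n))
      (CauchyFacts.inv-cauchy (seq y) (cauchy y) (proj₁ (proj₂ 0<y)) (positive⇒above {y} 0<y))

  -- At each index both Riemann sums have the same number of pieces, so their Lipschitz dependence
  -- on the endpoint suffices.
  ≈-ln : x ≈ y → ln x 0<x ≈ ln y 0<y
  ≈-ln x≈y = ≈-rescale {ln x 0<x} {ln y 0<y} D 0≤D λ ε 0<ε →
    eventually-zip (λ n (x≥ , y≥) close → ℚ.≤-trans
      (riemann-lipschitz n 0<δ (ℚ.p⊓q≤q η 1ℚ) x≥ y≥)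
      (subst (ℚ._≤ D ℚ.* ε) (ℚ.*-comm D ∣ seq x n ℚ.- seq y n ∣) (*-monoˡ 0≤D close)))
    above (x≈y ε 0<ε)

∑-≈ : ∀ {A : Set} (xs : List A) {g h : A → ℝ} → (∀ x → g x ≈ h x) → ∑ xs g ≈ ∑ xs h
∑-≈ []       g≈h = ≈-refl {0ℝ}
∑-≈ (x ∷ xs) {g} {h} g≈h = ≈-+ {g x} {h x} {∑ xs g} {∑ xs h} (g≈h x) (∑-≈ xs g≈h)

seq-∑ : ∀ {A : Set} (xs : List A) (g : A → ℝ) n → seq (∑ xs g) n ≡ ∑ℚ xs (λ x → seq (g x) n)
seq-∑ []       g n = refl
seq-∑ (x ∷ xs) g n = cong (seq (g x) n ℚ.+_) (seq-∑ xs g n)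

seq-^ : ∀ x k n → seq (x ^ k) n ≡ pow (seq x n) k
seq-^ x zero    n = refl
seq-^ x (suc k) n = cong (seq x n ℚ.*_) (seq-^ x k n)

infixr 3 _⊗_
_⊗_ : ∀ {P Q : ℕ → Set} → Eventually P → Eventually Q → Eventually (λ n → P n × Q n)
_⊗_ = eventually-zip (λ n → _,_)

below : ∀ {p ε r} → 0ℚ ℚ.< ε → p ℚ.+ ε ℚ.≤ r → p ℚ.< r
below {p} {ε} {r} 0<ε p+ε≤r = ℚ.<-≤-trans
  (subst (ℚ._< p ℚ.+ ε) (ℚ.+-identityʳ p) (ℚ.+-monoʳ-< p 0<ε)) p+ε≤r

fromℚ-cancel-< : ∀ {p q} → fromℚ p < fromℚ q → p ℚ.< q
fromℚ-cancel-< (ε , 0<ε , N , p+ε≤q) = below 0<ε (p+ε≤q N ℕ.≤-refl)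

<-≤-trans : ∀ {x y z} → x < y → y ≤ z → x < z
<-≤-trans {x} {y} {z} (ε , 0<ε , x+ε≤y) y≤z = ½ ℚ.* ε , 0<half 0<ε ,
  eventually-zip (λ n xy yz → 0≤-⇒≤ (subst (0ℚ ℚ.≤_)
    (trans (cong (λ e → (seq y n ℚ.- (seq x n ℚ.+ e)) ℚ.+ ((seq z n ℚ.+ ½ ℚ.* ε) ℚ.- seq y n))
             (sym (halves ε)))
      (solve 4 (λ x y z e → (y :- (x :+ (e :+ e))) :+ ((z :+ e) :- y) := z :- (x :+ e)) refl
        (seq x n) (seq y n) (seq z n) (½ ℚ.* ε)))
    (0≤+ (≤⇒0≤- xy) (≤⇒0≤- yz))))
  x+ε≤y (y≤z (½ ℚ.* ε) (0<half 0<ε))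

≤-<-trans : ∀ {x y z} → x ≤ y → y < z → x < z
≤-<-trans {x} {y} {z} x≤y (ε , 0<ε , y+ε≤z) = ½ ℚ.* ε , 0<half 0<ε ,
  eventually-zip (λ n xy yz → 0≤-⇒≤ (subst (0ℚ ℚ.≤_)
    (trans (cong (λ e → ((seq y n ℚ.+ ½ ℚ.* ε) ℚ.- seq x n) ℚ.+ (seq z n ℚ.- (seq y n ℚ.+ e)))
             (sym (halves ε)))
      (solve 4 (λ x y z e → ((y :+ e) :- x) :+ (z :- (y :+ (e :+ e))) := z :- (x :+ e)) refl
        (seq x n) (seq y n) (seq z n) (½ ℚ.* ε)))
    (0≤+ (≤⇒0≤- xy) (≤⇒0≤- yz))))
  (x≤y (½ ℚ.* ε) (0<half 0<ε)) y+ε≤z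

-- Expanding the product leaves an error linear in `η`, since `η` is at most 1 in the quadratic
-- term. Its coefficient uses only the upper bounds `c`, `l`, `b`, which can be chosen independently
-- of the index.
perturbed-bound : ∀ {T C L W y M η c l b U} →
  T ℚ.≤ C ℚ.* W ℚ.* U → U ℚ.≤ L ℚ.+ η → W ℚ.≤ y ℚ.+ M ℚ.* η →
  0ℚ ℚ.≤ C → 0ℚ ℚ.≤ L → 0ℚ ℚ.≤ W → 0ℚ ℚ.≤ M → 0ℚ ℚ.≤ η → η ℚ.≤ 1ℚ →
  C ℚ.≤ c → L ℚ.≤ l → y ℚ.≤ b → 0ℚ ℚ.≤ l → 0ℚ ℚ.≤ b →
  T ℚ.≤ C ℚ.* L ℚ.* y ℚ.+ c ℚ.* (M ℚ.* l ℚ.+ b ℚ.+ M) ℚ.* η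
perturbed-bound {T} {C} {L} {W} {y} {M} {η} {c} {l} {b} {U}
  T≤ U≤ W≤ 0≤C 0≤L 0≤W 0≤M 0≤η η≤1 C≤c L≤l y≤b 0≤l 0≤b = begin
  T                                          ≤⟨ T≤ ⟩
  C ℚ.* W ℚ.* U                              ≤⟨ *-monoˡ (0≤* 0≤C 0≤W) U≤ ⟩
  C ℚ.* W ℚ.* (L ℚ.+ η)                      ≤⟨ *-monoʳ (0≤+ 0≤L 0≤η) (*-monoˡ 0≤C W≤) ⟩
  C ℚ.* (y ℚ.+ M ℚ.* η) ℚ.* (L ℚ.+ η)
    ≡⟨ solve 5 (λ C y M η L → C :* (y :+ M :* η) :* (L :+ η)
                 := C :* L :* y :+ C :* (M :* L :+ y :+ M :* η) :* η) refl C y M η L ⟩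
  C ℚ.* L ℚ.* y ℚ.+ C ℚ.* (M ℚ.* L ℚ.+ y ℚ.+ M ℚ.* η) ℚ.* η
    ≤⟨ ℚ.+-monoʳ-≤ (C ℚ.* L ℚ.* y) (*-monoʳ 0≤η (ℚ.≤-trans
         (*-monoˡ 0≤C (ℚ.+-mono-≤ (ℚ.+-mono-≤ (*-monoˡ 0≤M L≤l) y≤b) Mη≤M))
         (*-monoʳ (0≤+ (0≤+ (0≤* 0≤M 0≤l) 0≤b) 0≤M) C≤c))) ⟩
  C ℚ.* L ℚ.* y ℚ.+ c ℚ.* (M ℚ.* l ℚ.+ b ℚ.+ M) ℚ.* η ∎
  where
  open ℚ.≤-Reasoning
  Mη≤M : M ℚ.* η ℚ.≤ M
  Mη≤M = subst (M ℚ.* η ℚ.≤_) (ℚ.*-identityʳ M) (*-monoˡ 0≤M η≤1)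

-- Dividing by a number at least 1 does not enlarge the error.
÷-bound : ∀ {T K y ε} → 1ℚ ℚ.≤ K → 0ℚ ℚ.≤ ε → T ℚ.≤ K ℚ.* y ℚ.+ ε → T ℚ.* inv K ℚ.≤ y ℚ.+ ε
÷-bound {T} {K} {y} {ε} 1≤K 0≤ε T≤ = ≤-cancelˡ 0<K (begin
  K ℚ.* (T ℚ.* inv K)     ≡⟨ trans (ℚ.*-comm K (T ℚ.* inv K)) (*-inv-cancelʳ′ T 0<K) ⟩
  T                       ≤⟨ T≤ ⟩
  K ℚ.* y ℚ.+ ε           ≡⟨ cong (K ℚ.* y ℚ.+_) (ℚ.*-identityˡ ε) ⟨
  K ℚ.* y ℚ.+ 1ℚ ℚ.* ε    ≤⟨ ℚ.+-monoʳ-≤ (K ℚ.* y) (*-monoʳ 0≤ε 1≤K) ⟩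
  K ℚ.* y ℚ.+ K ℚ.* ε     ≡⟨ ℚ.*-distribˡ-+ K y ε ⟨
  K ℚ.* (y ℚ.+ ε)         ∎)
  where
  open ℚ.≤-Reasoning
  0<K = ℚ.<-≤-trans 0<1 1≤K

-- Passage from rational approximations to the real bound

module _ {n : ℕ} (H : Hypergraph n) where

  open Hypergraph H

  private
    vertices : List (Fin n)
    vertices = allFin n

  -- Raising a real fractional transversal by η makes its rational approximations
  -- fractional transversals, because no edge is empty.
  raised-transversal : ∀ {w} → IsFractionalTransversal H w → ∀ η → 0ℚ ℚ.< η →
    Eventually (λ m → IsRationalFractionalTransversal H (λ x → seq (w x) m ℚ.+ η))
  raised-transversal {w} (0≤w , 1≤w) η 0<η = eventually-zip
    (λ m 0≤ 1≤ → (λ x → 0≤ (∈-allFin x)) , λ {F} F∈ → 1≤ F∈)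
    (eventually-all {P = λ x m → 0ℚ ℚ.≤ seq (w x) m ℚ.+ η} vertices (λ {x} _ → proj₁ (0≤w x) η 0<η))
    (eventually-all {P = λ F m → 1ℚ ℚ.≤ ∑ℚ (members F) (λ x → seq (w x) m ℚ.+ η)} edges λ {F} F∈ →
      eventually-map (λ m 1≤ → lift F m (edge-nonempty F∈) 1≤) (1≤w F∈ η 0<η))
    where
    members : Subset n → List (Fin n)
    members F = filter (_∈ˢ? F) vertices
    lift : ∀ F m → Nonempty F → 1ℚ ℚ.≤ seq (∑ (members F) w) m ℚ.+ η →
           1ℚ ℚ.≤ ∑ℚ (members F) (λ x → seq (w x) m ℚ.+ η)
    lift F m (x , x∈F) 1≤ = ℚ.≤-trans 1≤ (subst₂ ℚ._≤_
      (cong (ℚ._+ η) (sym (seq-∑ (members F) w m)))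
      (sym (∑ℚ-+ (members F) (λ x → seq (w x) m) (λ _ → η)))
      (ℚ.+-monoʳ-≤ (∑ℚ (members F) (λ x → seq (w x) m))
        (term≤∑ℚ {g = λ _ → η} (λ _ → ℚ.<⇒≤ 0<η) (∈-filter⁺ (_∈ˢ? F) (∈-allFin x) x∈F))))

  raised-total : ∀ w η m → ∑ℚ vertices (λ x → seq (w x) m ℚ.+ η)
                         ≡ seq (∑ vertices w) m ℚ.+ nat (length vertices) ℚ.* η
  raised-total w η m = trans (∑ℚ-+ vertices (λ x → seq (w x) m) (λ _ → η))
    (cong₂ ℚ._+_ (sym (seq-∑ vertices w m)) (∑ℚ-const vertices η))

  module Limit (k : ℕ) (p : ℝ) (0<p : 0ℝ < p) (p<1 : p < 1ℝ) where

    private f = suc k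

    C L K : ℝ
    C = (1ℝ - p ^ f) ÷ (1ℝ - p) [ x<y⇒0<y-x {p} {1ℝ} p<1 ]
    L = 1ℝ + ln (fromℕ (Δ H)) (fromℕ-positive (1≤Δ H)) - (fromℕ f - 1ℝ) * ln p 0<p
    K = C * L

    inside : Eventually (λ m → 0ℚ ℚ.< seq p m × seq p m ℚ.< 1ℚ)
    inside = eventually-zip
      (λ m δ≤p p+ε≤1 → ℚ.<-≤-trans (proj₁ (proj₂ 0<p)) δ≤p , below (proj₁ (proj₂ p<1)) p+ε≤1)
      (positive⇒above {p} 0<p) (proj₂ (proj₂ p<1))

    -- For an approximation below 1 the denominator is nonzero, so the total inverse is a genuine
    -- one and the quotient is the geometric sum exactly.
    seq-C : ∀ m → seq p m ℚ.< 1ℚ → seq C m ≡ geo (seq p m) f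
    seq-C m q<1 = trans
      (cong (ℚ._* inv (1ℚ ℚ.- q)) (trans (cong (λ x → 1ℚ ℚ.- x) (seq-^ p f m))
        (trans (sym (geo-telescope q f)) (ℚ.*-comm (1ℚ ℚ.- q) (geo q f)))))
      (*-inv-cancelʳ (geo q f) (subst (ℚ._< 1ℚ ℚ.- q) (ℚ.+-inverseʳ q) (ℚ.+-monoˡ-< (ℚ.- q) q<1)))
      where q = seq p m

    seq-L : ∀ m → seq L m ≡
      1ℚ ℚ.+ (nat k ℚ.* (ℚ.- riemann (seq p m) (suc m)) ℚ.+ riemann (nat (Δ H)) (suc m))
    seq-L m = solve 3 (λ k r s → (con 1ℚ :+ s) :+ (:- (((con 1ℚ :+ k) :+ (:- con 1ℚ)) :* r))
                              := con 1ℚ :+ (k :* (:- r) :+ s)) refl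
      (nat k) (riemann (seq p m) (suc m)) (riemann (nat (Δ H)) (suc m))

    1≤C : ∀ m → 0ℚ ℚ.< seq p m → seq p m ℚ.< 1ℚ → 1ℚ ℚ.≤ seq C m
    1≤C m 0<q q<1 = subst₂ ℚ._≤_
      (trans (cong (1ℚ ℚ.+_) (ℚ.*-zeroʳ (seq p m))) (ℚ.+-identityʳ 1ℚ)) (sym (seq-C m q<1))
      (geo-mono 0<q {1} {f} (ℕ.s≤s ℕ.z≤n))

    1≤L : ∀ m → 0ℚ ℚ.< seq p m → seq p m ℚ.< 1ℚ → 1ℚ ℚ.≤ seq L m
    1≤L m 0<q q<1 = subst₂ ℚ._≤_ (ℚ.+-identityʳ 1ℚ) (sym (seq-L m)) (ℚ.+-monoʳ-≤ 1ℚ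
      (0≤+ (0≤* (0≤nat k) (0≤-riemann m 0<q (ℚ.<⇒≤ q<1))) (riemann≥0 m (nat-mono (1≤Δ H)))))

    1≤K : ∀ m → 0ℚ ℚ.< seq p m → seq p m ℚ.< 1ℚ → 1ℚ ℚ.≤ seq K m
    1≤K m 0<q q<1 = subst (ℚ._≤ seq K m) (ℚ.*-identityˡ 1ℚ)
      (*-mono (ℚ.≤-trans 0≤1 (1≤C m 0<q q<1)) 0≤1 (1≤C m 0<q q<1) (1≤L m 0<q q<1))

    0<K : 0ℝ < K
    0<K = 1ℚ , 0<1 , eventually-map
      (λ m (0<q , q<1) → subst (ℚ._≤ seq K m) (sym (ℚ.+-identityˡ 1ℚ)) (1≤K m 0<q q<1)) inside

    -- The excess of the certificate from `log-bound` over the logarithmic terms of `L`: one Riemann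
    -- error for each of the `k` factors of λ^k.
    error : ℕ → ℚ
    error m = nat k ℚ.* (inv (nat (suc m)) ℚ.* inv (seq p m))

    error-small : ∀ η → 0ℚ ℚ.< η → Eventually (λ m → error m ℚ.≤ η)
    error-small η 0<η =
      let δ , 0<δ , _ = 0<p
          ρ , 0<ρ , _ , Dρ≤η = shrink {nat k ℚ.* inv δ} η (0≤* (0≤nat k) (ℚ.<⇒≤ (inv-pos 0<δ))) 0<η
      in eventually-zip (λ m δ≤p small → ℚ.≤-trans
           (*-monoˡ (0≤nat k) (*-mono (ℚ.<⇒≤ 0<ρ) (ℚ.<⇒≤ (inv-pos (ℚ.<-≤-trans 0<δ δ≤p)))
             small (inv-anti 0<δ δ≤p)))
           (subst (ℚ._≤ η) (solve 3 (λ k v r → k :* v :* r := k :* (r :* v)) refl (nat k) (inv δ) ρ) Dρ≤η))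
         (positive⇒above {p} 0<p) (inv-nat-small ρ 0<ρ)

    -- `T` stays fixed while the approximation of `p` varies, so an estimate at each late index
    -- passes to the limit.
    module _ (T : ℕ) (bound : Eventually (λ m → ∀ {w c} → IsRationalFractionalTransversal H w →
               LogBound (pow (seq p m) k) (nat (Δ H)) c →
               nat T ℚ.≤ geo (seq p m) f ℚ.* ∑ℚ vertices w ℚ.* (1ℚ ℚ.+ c))) where

      bound-fractional : ∀ {w y} → IsFractionalTransversal H w → y ≃ ∑ vertices w → fromℕ T ≤ K * y
      bound-fractional {w} {y} frac (_ , ∑w≤y) ε 0<ε =
        let c , 0≤c , C≤c = bounded (seq C) (cauchy C)
            l , 0≤l , L≤l = bounded (seq L) (cauchy L)
            b , 0≤b , y≤b = bounded (seq y) (cauchy y)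
            -- Raising costs `η` at every vertex, and one further `η` pays for comparing the total
            -- weight with `y`.
            M = nat (suc (length vertices))
            0≤M = 0≤nat (suc (length vertices))
            D = c ℚ.* (M ℚ.* l ℚ.+ b ℚ.+ M)
            0≤D = 0≤* {c} 0≤c (0≤+ {M ℚ.* l ℚ.+ b} {M} (0≤+ {M ℚ.* l} (0≤* {M} 0≤M 0≤l) 0≤b) 0≤M)
            η , 0<η , η≤1 , Dη≤ε = shrink {D} ε 0≤D 0<ε
        in eventually-map
             (λ { m ((0<q , q<1) , T≤ , isT , ∑w≤ , e≤η , C≤ , L≤ , y≤) →
               ℚ.≤-trans
                 (perturbed-bound {nat T} {seq C m} {seq L m} {total w η m} {seq y m} {M} {η} {c} {l} {b}
                   (subst (λ x → nat T ℚ.≤ x ℚ.* total w η m ℚ.* (1ℚ ℚ.+ logc m)) (sym (seq-C m q<1))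
                     (T≤ isT (log-bound m k 0<q (ℚ.<⇒≤ q<1) (nat-mono (1≤Δ H)))))
                   (subst (ℚ._≤ seq L m ℚ.+ η) (sym (split m)) (ℚ.+-monoʳ-≤ (seq L m) e≤η))
                   (total≤ {η = η} m ∑w≤)
                   (ℚ.≤-trans 0≤1 (1≤C m 0<q q<1)) (ℚ.≤-trans 0≤1 (1≤L m 0<q q<1))
                   (∑ℚ-≥0 vertices (proj₁ isT)) 0≤M (ℚ.<⇒≤ 0<η) η≤1
                   (ℚ.≤-trans (p≤∣p∣ (seq C m)) C≤) (ℚ.≤-trans (p≤∣p∣ (seq L m)) L≤)
                   (ℚ.≤-trans (p≤∣p∣ (seq y m)) y≤) 0≤l 0≤b)
                 (ℚ.+-monoʳ-≤ (seq K m ℚ.* seq y m) Dη≤ε) })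
             (inside ⊗ bound ⊗ raised-transversal {w} frac η 0<η ⊗ ∑w≤y η 0<η ⊗
               error-small η 0<η ⊗ C≤c ⊗ L≤l ⊗ y≤b)
        where
        total : (Fin n → ℝ) → ℚ → ℕ → ℚ
        total w η m = ∑ℚ vertices (λ x → seq (w x) m ℚ.+ η)
        logc : ℕ → ℚ
        logc m = nat k ℚ.* (inv (nat (suc m)) ℚ.* inv (seq p m) ℚ.- riemann (seq p m) (suc m))
                   ℚ.+ riemann (nat (Δ H)) (suc m)
        split : ∀ m → 1ℚ ℚ.+ logc m ≡ seq L m ℚ.+ error m
        split m = trans
          (solve 4 (λ k e r s → con 1ℚ :+ (k :* (e :- r) :+ s) := (con 1ℚ :+ (k :* (:- r) :+ s)) :+ k :* e)
            refl (nat k) (inv (nat (suc m)) ℚ.* inv (seq p m)) (riemann (seq p m) (suc m))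
            (riemann (nat (Δ H)) (suc m)))
          (cong (ℚ._+ error m) (sym (seq-L m)))
        total≤ : ∀ {η} m → seq (∑ vertices w) m ℚ.≤ seq y m ℚ.+ η →
                 total w η m ℚ.≤ seq y m ℚ.+ nat (suc (length vertices)) ℚ.* η
        total≤ {η} m ∑w≤ = subst₂ ℚ._≤_ (sym (raised-total w η m))
          (solve 3 (λ y e l → (y :+ e) :+ l :* e := y :+ (con 1ℚ :+ l) :* e) refl
            (seq y m) η (nat (length vertices)))
          (ℚ.+-monoˡ-≤ (nat (length vertices) ℚ.* η) ∑w≤)

      -- An infimum need not come with an optimal transversal. Instead T / K is shown to lie below
      -- every total weight, hence below `τ*`, and is then multiplied by `K` again.
      bound-limit : ∀ {τ*} → IsFractionalTransversalNumber H τ* → fromℕ T ≤ C * τ* * L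
      bound-limit {τ*} (_ , greatest) ε 0<ε =
        let κ , 0≤κ , K≤κ = bounded (seq K) (cauchy K)
            η , 0<η , _ , κη≤ε = shrink {κ} ε 0≤κ 0<ε
        in eventually-map
             (λ { m ((0<q , q<1) , T/K≤ , K≤) → begin
               nat T
                 ≡⟨ *-inv-cancelʳ′ (nat T) (0<Kₘ m 0<q q<1) ⟨
               nat T ℚ.* inv (seq K m) ℚ.* seq K m
                 ≤⟨ *-monoʳ (ℚ.<⇒≤ (0<Kₘ m 0<q q<1)) T/K≤ ⟩
               (seq τ* m ℚ.+ η) ℚ.* seq K m
                 ≡⟨ solve 4 (λ t e C L → (t :+ e) :* (C :* L) := C :* t :* L :+ C :* L :* e) refl
                      (seq τ* m) η (seq C m) (seq L m) ⟩
               seq C m ℚ.* seq τ* m ℚ.* seq L m ℚ.+ seq K m ℚ.* η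
                 ≤⟨ ℚ.+-monoʳ-≤ (seq C m ℚ.* seq τ* m ℚ.* seq L m) (ℚ.≤-trans
                      (*-monoʳ (ℚ.<⇒≤ 0<η) (ℚ.≤-trans (p≤∣p∣ (seq K m)) K≤)) κη≤ε) ⟩
               seq C m ℚ.* seq τ* m ℚ.* seq L m ℚ.+ ε ∎ })
             (inside ⊗ T/K≤τ* η 0<η ⊗ K≤κ)
        where
        open ℚ.≤-Reasoning
        0<Kₘ : ∀ m → 0ℚ ℚ.< seq p m → seq p m ℚ.< 1ℚ → 0ℚ ℚ.< seq K m
        0<Kₘ m 0<q q<1 = ℚ.<-≤-trans 0<1 (1≤K m 0<q q<1)
        T/K≤τ* : fromℕ T ÷ K [ 0<K ] ≤ τ*
        T/K≤τ* = greatest (fromℕ T ÷ K [ 0<K ]) λ { y (w , frac , y≃) ε 0<ε → eventually-zip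
          (λ m (0<q , q<1) T≤ → ÷-bound {nat T} {seq K m} {seq y m} {ε} (1≤K m 0<q q<1) (ℚ.<⇒≤ 0<ε) T≤)
          inside (bound-fractional {w} {y} frac y≃ ε 0<ε) }

-- The greedy algorithm for real λ

when-× : ∀ {P Q : Set} (P? : Dec P) (Q? : Dec Q) r → when (P? ×-dec Q?) r ≡ when P? (when Q? r)
when-× (yes _) (yes _) r = refl
when-× (yes _) (no _)  r = refl
when-× (no _)  _       r = refl

module _ {n : ℕ} (H : Hypergraph n) where

  open Hypergraph H

  module _ {lam : ℝ} {f : ℕ} where

    open Greedy H lam f

    map-yields : ∀ {P Q : Multiset H → Set} → (∀ {A} → P A → Q A) →
                 ∀ {A} → GreedyYields P A → GreedyYields Q A
    map-yields P⊆Q (stop t pA)            = stop t (P⊆Q pA)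
    map-yields P⊆Q (pick ¬t choice continue) =
      pick ¬t choice (λ x x-best → map-yields P⊆Q (continue x x-best))

    output : ∀ {P : Multiset H → Set} {A} → GreedyYields P A → ∃[ B ] P B
    output {A = A} (stop _ pA)            = A , pA
    output (pick _ (x , x-best) continue) = output (continue x x-best)

  module _ {lam : ℝ} {q : ℚ} (f : ℕ) (lam≈q : lam ≈ fromℚ q) (0<q : 0ℚ ℚ.< q) (q≤1 : q ℚ.≤ 1ℚ) where

    open Greedy H lam f
    open RationalGreedy H f q

    value≈val : ∀ A x → value A x ≈ fromℚ (val A x)
    value≈val A x = ≈-trans {value A x} {∑ live (λ F → fromℚ q ^ hits H A F)} {fromℚ (val A x)}
      (∑-≈ live (λ F → ≈-^ {lam} {fromℚ q} lam≈q (hits H A F)))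
      (seq≡⇒≈ {∑ live (λ F → fromℚ q ^ hits H A F)} {fromℚ (val A x)} λ m →
        trans (seq-∑ live (λ F → fromℚ q ^ hits H A F) m)
          (trans (∑ℚ-filter live? edges (λ F → seq (fromℚ q ^ hits H A F) m))
            (∑ℚ-cong edges λ F → trans (cong (when (live? F)) (seq-^ (fromℚ q) (hits H A F) m))
              (when-× (x ∈ˢ? F) (hits H A F ℕ.<? f) (pow q (hits H A F))))))
      where
      live? = λ F → (x ∈ˢ? F) ×-dec (hits H A F ℕ.<? f)
      live  = filter live? edges

    -- Values computed with λ and with `q` have equal limits, and an inequality between limits of
    -- constant sequences is one between the rationals themselves.
    greedy⇒largest : ∀ {A x} → IsGreedyChoice A x → IsLargest A x
    greedy⇒largest {A} {x} best y = fromℚ-cancel-≤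
      (≤-trans {fromℚ (val A y)} {value A y} {fromℚ (val A x)}
        (≈⇒≤ {fromℚ (val A y)} {value A y} (≈-sym {value A y} {fromℚ (val A y)} (value≈val A y)))
        (≤-trans {value A y} {value A x} {fromℚ (val A x)} (best y)
          (≈⇒≤ {value A x} {fromℚ (val A x)} (value≈val A x))))

    largest⇒greedy : ∀ {A x} → IsLargest A x → IsGreedyChoice A x
    largest⇒greedy {A} {x} largest y = ≤-trans {value A y} {fromℚ (val A y)} {value A x}
      (≈⇒≤ {value A y} {fromℚ (val A y)} (value≈val A y))
      (≤-trans {fromℚ (val A y)} {fromℚ (val A x)} {value A x} (fromℚ-mono-≤ (largest y))
        (≈⇒≤ {fromℚ (val A x)} {value A x} (≈-sym {value A x} {fromℚ (val A x)} (value≈val A x))))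

    greedy-choice : ∀ A → ∃[ x ] IsGreedyChoice A x
    greedy-choice A = x , largest⇒greedy {A} {x} λ y →
      All.lookup (f[xs]≤f[argmax] {f = val A} x₀ (allFin n)) (∈-allFin y)
      where
      -- A default vertex for the maximum, taken from a nonempty edge.
      x₀ = proj₁ (edge-nonempty (proj₂ edges-nonempty))
      x  = argmax (val A) x₀ (allFin n)

    private
      μ : ℚ
      μ = pow q (ℕ.pred f)

    -- Each pick lowers the nonnegative potential by at least `μ`, so `N` bounds the number of picks
    -- still possible and the recursion runs on it.
    yields-runs : ∀ N A → Run A → potential A ℚ.≤ nat N ℚ.* μ →
                  GreedyYields (λ B → IsTransversal H f B × Run B) A
    yields-runs N A run Φ≤Nμ = decide (transversal? H f A)
      where
      pick-next : ∀ N → potential A ℚ.≤ nat N ℚ.* μ → ¬ IsTransversal H f A →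
                  ∀ x → IsGreedyChoice A x → GreedyYields (λ B → IsTransversal H f B × Run B) (x ∷ A)
      pick-next N Φ≤Nμ ¬t x best = next N Φ≤Nμ
        where
        largest : IsLargest A x
        largest = greedy⇒largest {A} {x} best
        Φ′ = potential (x ∷ A)
        μ+Φ′≤Φ : μ ℚ.+ Φ′ ℚ.≤ potential A
        μ+Φ′≤Φ = subst (μ ℚ.+ Φ′ ℚ.≤_) (sym (potential-pick A x))
          (ℚ.+-monoˡ-≤ Φ′ (largest-lower 0<q q≤1 {A} {x} ¬t largest))
        next : ∀ N → potential A ℚ.≤ nat N ℚ.* μ →
               GreedyYields (λ B → IsTransversal H f B × Run B) (x ∷ A)
        -- With no pick left the potential would be at most 0, yet it is at least the positive
        -- `μ + Φ′`.
        next zero Φ≤0 = ⊥-elim (ℚ.<-irrefl refl (ℚ.<-≤-trans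
          (0<+ (pow-pos 0<q (ℕ.pred f)) (potential-≥0 0<q q≤1 (x ∷ A)))
          (ℚ.≤-trans μ+Φ′≤Φ (subst (potential A ℚ.≤_) (ℚ.*-zeroˡ μ) Φ≤0))))
        next (suc N) Φ≤Nμ = yields-runs N (x ∷ A) (pick run ¬t largest) (0≤-⇒≤ (subst (0ℚ ℚ.≤_)
          (solve 4 (λ N μ Φ Φ′ → ((con 1ℚ :+ N) :* μ :- Φ) :+ (Φ :- (μ :+ Φ′)) := N :* μ :- Φ′) refl
            (nat N) μ (potential A) Φ′)
          (0≤+ (≤⇒0≤- Φ≤Nμ) (≤⇒0≤- μ+Φ′≤Φ))))
      decide : Dec (IsTransversal H f A) → GreedyYields (λ B → IsTransversal H f B × Run B) A
      decide (yes t) = stop t (t , run)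
      decide (no ¬t) = pick ¬t (greedy-choice A) (pick-next N Φ≤Nμ ¬t)

    greedy-terminates : GreedyYields (λ B → IsTransversal H f B × Run B) []
    greedy-terminates = yields-runs (suc N) [] [] (begin
      Φ                            ≡⟨ *-inv-cancelʳ Φ 0<μ ⟨
      Φ ℚ.* μ ℚ.* inv μ            ≡⟨ solve 3 (λ Φ μ v → Φ :* μ :* v := (Φ :* v) :* μ) refl Φ μ (inv μ) ⟩
      Φ ℚ.* inv μ ℚ.* μ            ≤⟨ *-monoʳ (ℚ.<⇒≤ 0<μ) Φ/μ≤ ⟩
      nat (suc N) ℚ.* μ            ∎)
      where
      open ℚ.≤-Reasoning
      0<μ = pow-pos 0<q (ℕ.pred f)
      Φ = potential []
      r = Φ ℚ.* inv μ
      0≤r : 0ℚ ℚ.≤ r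
      0≤r = 0≤* (potential-≥0 0<q q≤1 []) (ℚ.<⇒≤ (inv-pos 0<μ))
      0<1+r : 0ℚ ℚ.< 1ℚ ℚ.+ r
      0<1+r = 0<+ 0<1 0≤r
      -- Applied to 1 / (1 + r), the Archimedean property gives N + 1 at least 1 + r, hence above
      -- the ratio of potential to `μ`.
      arch = archimedean (inv (1ℚ ℚ.+ r)) (inv-pos 0<1+r)
      N = proj₁ arch
      Φ/μ≤ : r ℚ.≤ nat (suc N)
      Φ/μ≤ = ℚ.≤-trans
        (subst (ℚ._≤ 1ℚ ℚ.+ r) (ℚ.+-identityˡ r) (ℚ.+-monoˡ-≤ r 0≤1))
        (subst₂ ℚ._≤_ (ℚ.*-identityˡ (1ℚ ℚ.+ r)) (*-inv-cancelʳ′ (nat (suc N)) 0<1+r)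
          (*-monoʳ (ℚ.<⇒≤ 0<1+r) (proj₂ arch)))

-- Continuity of the bound in λ, and both claims of the theorem

module _ {n : ℕ} (H : Hypergraph n) where

  C*τ*L-cong : ∀ k {x y} (0<x : 0ℝ < x) (x<1 : x < 1ℝ) (0<y : 0ℝ < y) (y<1 : y < 1ℝ) τ* → x ≈ y →
    Limit.C H k x 0<x x<1 * τ* * Limit.L H k x 0<x x<1 ≈
    Limit.C H k y 0<y y<1 * τ* * Limit.L H k y 0<y y<1
  C*τ*L-cong k {x} {y} 0<x x<1 0<y y<1 τ* x≈y =
    ≈-* {X.C * τ*} {Y.C * τ*} {X.L} {Y.L} (≈-* {X.C} {Y.C} {τ*} {τ*} C≈ (≈-refl {τ*})) L≈
    where
    module X = Limit H k x 0<x x<1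
    module Y = Limit H k y 0<y y<1
    1-≈ : ∀ {u v} → u ≈ v → 1ℝ - u ≈ 1ℝ - v
    1-≈ {u} {v} u≈v = ≈-+ {1ℝ} {1ℝ} { - u} { - v} (≈-refl {1ℝ}) (≈-neg {u} {v} u≈v)
    C≈ : X.C ≈ Y.C
    C≈ = ≈-÷ {1ℝ - x} {1ℝ - y} (x<y⇒0<y-x {x} {1ℝ} x<1) (x<y⇒0<y-x {y} {1ℝ} y<1)
      {1ℝ - x ^ suc k} {1ℝ - y ^ suc k}
      (1-≈ {x ^ suc k} {y ^ suc k} (≈-^ {x} {y} x≈y (suc k))) (1-≈ {x} {y} x≈y)
    lnΔ = ln (fromℕ (Δ H)) (fromℕ-positive (1≤Δ H))
    f-1 = fromℕ (suc k) - 1ℝ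
    L≈ : X.L ≈ Y.L
    L≈ = ≈-+ {1ℝ + lnΔ} {1ℝ + lnΔ} { - (f-1 * ln x 0<x)} { - (f-1 * ln y 0<y)}
      (≈-refl {1ℝ + lnΔ})
      (≈-neg {f-1 * ln x 0<x} {f-1 * ln y 0<y} (≈-* {f-1} {f-1} {ln x 0<x} {ln y 0<y}
        (≈-refl {f-1}) (≈-ln {x} {y} 0<x 0<y x≈y)))

theorem1p1 : ∀ {n} (H : Hypergraph n)
      (lam : ℝ) (0<lam : 0ℝ < lam) (lam<1 : lam < 1ℝ)
      (f : ℕ) → 1 ℕ.≤ f →
    (τ-f : ℕ) → IsTransversalNumber H f τ-f →
    (τ* : ℝ) → IsFractionalTransversalNumber H τ* →
    let rhs = ((1ℝ - lam ^ f) ÷ (1ℝ - lam) [ x<y⇒0<y-x {lam} {1ℝ} lam<1 ])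
                * τ* *
                (1ℝ + ln (fromℕ (Δ H)) (fromℕ-positive (1≤Δ H)) - (fromℕ f - 1ℝ) * ln lam 0<lam)
    in
    (fromℕ τ-f ≤ rhs)
      × (IsRational lam →
          Greedy.GreedyYields H lam f
            (λ A → IsTransversal H f A × (fromℕ (length A) ≤ rhs))
            [])
theorem1p1 H lam 0<lam lam<1 (suc k) 1≤f τ-f (_ , minimal) τ* inf = bound , greedy
  where
  f = suc k
  open Limit H k

  bound : fromℕ τ-f ≤ C lam 0<lam lam<1 * τ* * L lam 0<lam lam<1
  -- Each approximation of λ in (0,1) has its own greedy output, and by minimality all of these have
  -- at least `τ-f` elements.
  bound = bound-limit lam 0<lam lam<1 τ-f (eventually-map
    (λ m (0<q , q<1) {w} {c} frac logB →
      let q≤1 = ℚ.<⇒≤ q<1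
          lamₘ = fromℚ (seq lam m)
          A , t , run = output H (greedy-terminates H {lamₘ} f (≈-refl {lamₘ}) 0<q q≤1)
      in ℚ.≤-trans (nat-mono (minimal A t))
           (RationalGreedy.run-length H f (seq lam m) 0<q q≤1 {w} {c} frac logB run))
    (inside lam 0<lam lam<1)) {τ*} inf

  greedy : IsRational lam → Greedy.GreedyYields H lam f
    (λ A → IsTransversal H f A × (fromℕ (length A) ≤ C lam 0<lam lam<1 * τ* * L lam 0<lam lam<1)) []
  greedy (q , lam≤q , q≤lam) = map-yields H
    (λ {A} (t , run) → (λ {F} → t {F}) , ≤-trans {fromℕ (length A)} {rhs-q} {rhs-lam}
      -- The output is fixed and the sequence for `q` is constant, so the same run serves every
      -- index; only then is the bound carried from `q` to λ.
      (bound-limit (fromℚ q) 0<q q<1 (length A) (always λ m {w} {c} frac logB →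
        RationalGreedy.run-length H f q 0<qℚ q≤1 {w} {c} frac logB run) {τ*} inf)
      (≈⇒≤ {rhs-q} {rhs-lam} (C*τ*L-cong H k 0<q q<1 0<lam lam<1 τ* (≈-sym {lam} {fromℚ q} lam≈q))))
    (greedy-terminates H {lam} f lam≈q 0<qℚ q≤1)
    where
    lam≈q : lam ≈ fromℚ q
    lam≈q = ≃⇒≈ {lam} {fromℚ q} (lam≤q , q≤lam)
    0<q : 0ℝ < fromℚ q
    0<q = <-≤-trans {0ℝ} {lam} {fromℚ q} 0<lam lam≤q
    q<1 : fromℚ q < 1ℝ
    q<1 = ≤-<-trans {fromℚ q} {lam} {1ℝ} q≤lam lam<1
    0<qℚ = fromℚ-cancel-< {0ℚ} {q} 0<q
    q≤1 = ℚ.<⇒≤ (fromℚ-cancel-< {q} {1ℚ} q<1)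
    rhs-q   = C (fromℚ q) 0<q q<1 * τ* * L (fromℚ q) 0<q q<1
    rhs-lam = C lam 0<lam lam<1 * τ* * L lam 0<lam lam<1
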